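{- Let $\mathbf{P}=(\rho_0,R,\mathcal{N}_0,t,\mathrm{Seq},\Pi)$ be a proof schema all of whose $s$-proofs $\xi_i(\rho)$ contain only quantifier-free cuts and have skolemized prenex end-sequents, and let $t(\rho_0)=(n_1,\ldots,n_k)$. Then the Herbrand system of $\mathbf{P}$ is sound and complete. That is, for every occurrence $\mu_0$ in $\mathrm{Seq}(\rho_0)$ of a formula $F=Qx_1\ldots Qx_\beta\,F'(x_1,\ldots,x_\beta)$ with $Q\in\{\forall,\exists\}$ and $F'$ quantifier-free, and every parameter assignment $\sigma$, writing $\varphi_\sigma=\sigma(\rho_0(n_1,\ldots,n_k))\!\downarrow$ for the evaluated $\mathbf{LK}$-proof: (Soundness) every substitution $\theta\in\sigma(\Theta^*(\rho_0,\mu_0))\!\downarrow$ arises from the instantiations performed along the ancestors of $\mu_0$ in the proof and yields a Herbrand instance occurring in $\varphi_\sigma$, i.e. $\sigma(F')\theta$ is the formula at some ancestor occurrence in $\varphi_\sigma$ of the occurrence corresponding to $\mu_0$ in the end-sequent of $\varphi_\sigma$; (Completeness) every Herbrand instance occurring in $\varphi_\sigma$ is generated, i.e. for every trace $\tau$ in $\varphi_\sigma$ which starts at the occurrence corresponding to $\mu_0$ in the end-sequent and ends in an axiom, the substitution $hi(\tau)$ belongs to $\sigma(\Theta^*(\rho_0,\mu_0))\!\downarrow$.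
   Context: **Language.** Pairwise disjoint sets: parameters $\mathcal{N}$ (variables over the natural numbers), ordinary free variables $V_f$, bound variables $V_b$. Terms ($\mathcal{N}$-semi-terms) are built from all these variables, $\bar 0$, the unary $s$ (successor), $p$ (predecessor) and further function symbols; $\mathcal{N}$-terms are those without bound variables. $\mathcal{N}$-formulas are built from atoms over $\mathcal{N}$-terms by $\neg,\land,\lor,\to$ and quantification ($\forall y.F\{x\leftarrow y\}$, $\exists y.F\{x\leftarrow y\}$ for $x\in\mathcal{N}\cup V_f$, $y\in V_b$). The predicate symbols include $=,<,>,\le,\ge$. $\mathcal{N}$-sequents $\Gamma\vdash\Delta$ consist of multisets of $\mathcal{N}$-formulas. $T_0$ is the set of terms built from parameters, $\bar 0,s,p$ only. With $p(\bar 0)=\bar 0$, $p(s(x))=x$, every parameter-free term of $T_0$ evaluates to (and is identified with) a numeral $s^\alpha(\bar 0)$. A parameter assignment $\sigma$ maps parameters to numerals; it extends homomorphically to terms, formulas and sequents (fixing $V_f$ and $V_b$, evaluating parameter-free terms of $T_0$ to numerals). A parameter substitution maps finitely many parameters to terms in $T_0$. **Calculus.** $\mathbf{LK}$ is Gentzen's sequent calculus on multiset sequents (multiplicative binary rules, weakening, contraction, cut, the usual rules for $\neg,\land,\lor,\to,\forall,\exists$). $\mathbf{LK}_{\mathcal N}$ is the same calculus on $\mathcal{N}$-sequents, where eigenvariables of $\forall_r,\exists_l$ must belong to $V_f$ (never to $\mathcal{N}$). Axioms are atomic sequents: tautological ones, those valid in first-order logic with equality, and the $C$-axioms defined below. Applying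 $\sigma$ to a proof means applying it to all its sequents. **Conditions.** Atomic conditions are $\top,\bot$, $s^\alpha(v)\,\triangle\,s^\beta(\bar 0)$ and $s^\alpha(v)\,\triangle\,s^\beta(w)$ with $v,w$ different parameters, $\triangle\in\{=,<,>,\le,\ge\}$; conditions are Boolean combinations ($\neg,\land,\lor$) of these. A finite set of conditions is a partition if under every parameter assignment exactly one of them is true. **Proof schemata.** To each proof symbol $\rho$ are assigned a finite parameter set $\mathcal{N}(\rho)$ and an $\mathcal{N}$-sequent $\mathrm{Seq}(\rho)$ whose set of parameters is $\mathcal{N}(\rho)$. If $\mathcal N(\rho)=\{m_1,\ldots,m_l\}$ then $\rho(m_1,\ldots,m_l)$ is its proof term, and $\rho(m_1,\ldots,m_l)\theta$ is also a proof term for a parameter substitution $\theta$. An $s$-proof corresponding to $\rho$ is an $\mathbf{LK}_{\mathcal N}$-derivation of $\mathrm{Seq}(\rho)$ (its core), with set of parameters $\mathcal{N}(\rho)$, in which some initial sequents $S'$ are the conclusion of a call inference with premise a proof term $\rho'(k_1,\ldots,k_r)\theta$, where $\mathrm{Seq}(\rho')\theta=S'$. A semi-proof schema is a tuple $(\rho_0,R,\mathcal{N}_0,t,\mathrm{Seq},\Pi)$ with $R$ a finite set of proof symbols, $\rho_0\in R$ (main proof symbol), $\mathcal{N}_0$ a finite set of parameters, $t(\rho)$ the tuple of parameters of $\rho$ (from $\mathcal{N}_0$), and $\Pi$ assigning to each $\rho\in R$ with $t(\rho)=(m_1,\ldots,m_l)$ a definition $\rho(m_1,\ldots,m_l)=\{C_1:\xi_1(\rho),\ldots,C_k:\xi_k(\rho)\}$,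 where $\{C_1,\ldots,C_k\}$ is a partition and each $\xi_j(\rho)$ is an $s$-proof corresponding to $\rho$ whose leaves are axioms or proof terms for symbols in $R$. In $\xi_j(\rho)$ one may also use as axioms ($C_j$-axioms) sequents of atoms $u\circ v$ with $u,v\in T_0$, $\circ\in\{<,>,=,\le,\ge\}$, that are entailed by $C_j$ under the standard interpretation. The associated point transition system has, for each $\rho$ and $j$, the transition $(\rho,t(\rho))\to\mathcal{L}_j:C_j$, where $\mathcal{L}_j$ is the set of pairs $(\rho',(u_1,\ldots,u_r))$ for proof terms $\rho'(u_1,\ldots,u_r)$ at leaves of $\xi_j(\rho)$ (or $\{(\delta_e,t(\rho))\}$, $\delta_e$ a fresh end label, if there are none). Write $\rho\to^*\rho'$ for the transitive closure of "$\rho'$ occurs in some $\mathcal{L}_j$ of $\rho$". The semi-proof schema is a *proof schema* if the system is canonic: there is a well-founded (Noetherian) strict ordering $<_l$ on tuples of numerals such that for every transition $(\rho,q)\to\mathcal{L}:C$ and every $(\rho',q')\in\mathcal{L}$, either ($\rho\to^*\rho'$ and not $\rho'\to^*\rho$), or ($\rho\to^*\rho'$, $\rho'\to^*\rho$ and $\sigma(q')<_l\sigma(q)$ for all $\sigma$ with $\sigma(C)=\top$). **Evaluation.** $\sigma(\rho(m_1,\ldots,m_l))\!\downarrow$ is obtained by taking the unique $j$ with $\sigma(C_j)=\top$, applying $\sigma$ to the core of $\xi_j(\rho)$, and replacing each initial sequent that is the conclusion of a call $\rho'(k_1,\ldots,k_r)\theta$ with $\theta=\{k_i\leftarrow u_i\}$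 by $\sigma'(\rho'(k_1,\ldots,k_r))\!\downarrow$, where $\sigma'(k_i)=\sigma(u_i)$. For a proof schema this is an $\mathbf{LK}$-proof of $\sigma(\mathrm{Seq}(\rho))$ from the $\sigma$-images of the axioms. **Traces.** A skolemized sequent is one without strong quantifiers ($\forall$ of positive or $\exists$ of negative polarity). In a proof or $s$-proof $\varphi$, a thread is a path of sequent occurrences $\nu_0,\ldots,\nu_\alpha$ from the end-sequent to an initial sequent. A trace of a formula occurrence $\mu_0$ of the end-sequent is a sequence $\mu_0,\ldots,\mu_\alpha$ along a thread, with $\mu_i$ an occurrence in the sequent at $\nu_i$ and $\mu_{i+1}$ an (immediate) ancestor of $\mu_i$. Its yield is the sequence of the formulas at $\mu_0,\ldots,\mu_\alpha$. If the thread ends in a proof term of a call inference, its conclusion is the sequent at $\nu_{\alpha-1}$. For $\mu_0$ an occurrence of $F=Qx_1\ldots Qx_\beta F'$, define $hi(\tau)$: if $\tau$ ends in an axiom, then $F'(t_1,\ldots,t_\beta)$ occurs in the yield for some terms $t_i$ and $hi(\tau)=\{x_1\leftarrow t_1,\ldots,x_\beta\leftarrow t_\beta\}$. If $\tau$ ends in a call, let $G$ be the formula at $\mu_{\alpha-1}$: if $G=F$, then $hi(\tau)=\emptyset$; if $G=Qx_{i+1}\ldots Qx_\beta F'(t_1,\ldots,t_i,x_{i+1},\ldots,x_\beta)$ with $1\le i<\beta$, then $hi(\tau)=\{x_1\leftarrow t_1,\ldots,x_i\leftarrow t_i\}$; if $G$ is a subformula of some $F'(t_1,\ldots,t_\beta)$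 occurring in the yield, then $hi(\tau)=\{x_1\leftarrow t_1,\ldots,x_\beta\leftarrow t_\beta\}$. **Herbrand system.** For $\rho\in R$ and an occurrence $\mu$ in $\mathrm{Seq}(\rho)$ of a formula $Qx_1\ldots Qx_\beta F'$, the Herbrand system $\Theta^*(\rho,\mu)$ is the recursive definition over the same partition $C_1,\ldots,C_k$ as $\rho$, given under $C_j$ by the union over all traces $\tau$ of $\mu$ in $\xi_j(\rho)$. Its evaluation $\sigma(\Theta^*(\rho,\mu))\!\downarrow$ under a parameter assignment $\sigma$ is the union, over all traces $\tau$ of $\mu$ in $\xi_j(\rho)$, $j$ being the unique index with $\sigma(C_j)=\top$, of the sets: 1. $\{\sigma(hi(\tau))\}$, if the formula at the end of $\tau$ is quantifier-free (at an axiom or at a call); 2. $\sigma'(\Theta^*(\rho',\mu'))\!\downarrow$, if $\tau$ ends in a call $\rho'(k_1,\ldots,k_r)\theta$ with the formula at $\mu_{\alpha-1}$ still equal to $F$; 3. $\{\,\sigma(\{x_1\leftarrow t_1,\ldots,x_i\leftarrow t_i\})\,\eta \mid \eta\in\sigma'(\Theta^*(\rho',\mu'))\!\downarrow\}$ (combination of substitutions), if $\tau$ ends in such a call with formula $Qx_{i+1}\ldots Qx_\beta F'(t_1,\ldots,t_i,x_{i+1},\ldots,x_\beta)$ at $\mu_{\alpha-1}$. Here $\mu'$ is the corresponding occurrence in $\mathrm{Seq}(\rho')$ and $\sigma'(k_i)=\sigma(k_i\theta)$. The Herbrand system of $\mathbf{P}$ is given by the $\Theta^*(\rho_0,\mu_0)$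 for the quantified occurrences $\mu_0$ in $\mathrm{Seq}(\rho_0)$. -}

module Defs where

open import Data.Bool.Base using (Bool; true; false; not; _∧_; _∨_)
open import Data.Empty using (⊥)
open import Data.Fin.Base using (Fin; zero; suc; splitAt; _↑ˡ_; _↑ʳ_)
open import Data.Fin.Induction using (spo-wellFounded)
open import Data.Fin.Permutation as Perm using (_⟨$⟩ˡ_)
open import Data.Fin.Properties using (any?)
open import Data.List.Base as List using (List; []; _∷_; _∷ʳ_)
open import Data.List.Membership.Propositional using (_∈_)
open import Data.Maybe.Base using (Maybe; just; nothing)
open import Data.Nat.Base using (ℕ; zero; suc; pred; _+_; _≤_; _≡ᵇ_; _<ᵇ_; _≤ᵇ_)
open import Data.Product.Base using (Σ-syntax; ∃-syntax; _×_; _,_; proj₁; proj₂)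
open import Data.Product using (∃!)
open import Data.Sign.Base using (Sign; opposite)
open import Data.Sum.Base as Sum using (_⊎_; inj₁; inj₂; [_,_]′)
open import Data.Unit.Base using (⊤)
open import Data.Vec.Base as Vec using (Vec; []; _∷_; lookup)
open import Data.Vec.Functional.Relation.Binary.Permutation using (_↭_)
import Data.Vec.Membership.Propositional as VecMem
import Data.Vec.Properties as Vecₚ
open import Data.Vec.Relation.Unary.All using (All)
open import Data.Vec.Relation.Unary.Any using (Any)
open import Data.Vec.Relation.Unary.Unique.Propositional using (Unique)
open import Data.Vec.Relation.Unary.Unique.Propositional.Properties using (lookup-injective)
open import Function.Base using (_∘_; id)
open import Function.Bundles using (_⇔_)
open import Induction.WellFounded using (WellFounded; Acc; acc)
open import Level using (0ℓ)
open import Relation.Binary.Construct.Closure.Transitive using (TransClosure; [_]; _∷_; _++_)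
open import Relation.Binary.Core using (Rel)
open import Relation.Binary.Definitions using (DecidableEquality)
open import Relation.Binary.PropositionalEquality
  using (_≡_; _≢_; refl; sym; trans; cong; cong₂; subst; isEquivalence; module ≡-Reasoning)
open import Relation.Binary.Structures using (IsStrictPartialOrder)
open import Relation.Nullary using (¬_; yes; no; contradiction)

------------------------------------------------------------------------
-- Sequents as pairs of finite multisets: a multiset is a vector up to
-- permutation; the positions in it are the formula occurrences.

record Seqt (A : Set) : Set where
  constructor _⊢_
  field
    {#ante #succ} : ℕ
    ante : Vec A #ante
    succ : Vec A #succ

open Seqt public

infix 3 _⊢_

Occ : {A : Set} → Seqt A → Set
Occ S = Fin (#ante S) ⊎ Fin (#succ S)

infixl 8 _at_

_at_ : {A : Set} (S : Seqt A) → Occ S → A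
S at inj₁ i = lookup (ante S) i
S at inj₂ i = lookup (succ S) i

-- Occ (mapˢ f S) and Occ S are definitionally equal, so an occurrence in S
-- is at the same time the corresponding occurrence in mapˢ f S.

mapˢ : {A B : Set} → (A → B) → Seqt A → Seqt B
mapˢ f (Γ ⊢ Δ) = Vec.map f Γ ⊢ Vec.map f Δ

infixr 5 _⊕_

_⊕_ : {A : Set} → Seqt A → Seqt A → Seqt A
(Γ ⊢ Δ) ⊕ (Γ′ ⊢ Δ′) = (Γ Vec.++ Γ′) ⊢ (Δ Vec.++ Δ′)

infix 4 _≋_

record _≋_ {A : Set} (S T : Seqt A) : Set where
  constructor _,_
  field
    ante↭ : lookup (ante S) ↭ lookup (ante T)
    succ↭ : lookup (succ S) ↭ lookup (succ T)

move : {A : Set} {S T : Seqt A} → S ≋ T → Occ S → Occ T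
move (p , q) = Sum.map (proj₁ p ⟨$⟩ˡ_) (proj₁ q ⟨$⟩ˡ_)

split : {A : Set} (S T : Seqt A) → Occ (S ⊕ T) → Occ S ⊎ Occ T
split S T (inj₁ i) = Sum.map inj₁ inj₁ (splitAt (#ante S) i)
split S T (inj₂ i) = Sum.map inj₂ inj₂ (splitAt (#succ S) i)

inˡ : {A : Set} (S T : Seqt A) → Occ S → Occ (S ⊕ T)
inˡ S T = Sum.map (_↑ˡ #ante T) (_↑ˡ #succ T)

inʳ : {A : Set} (S T : Seqt A) → Occ T → Occ (S ⊕ T)
inʳ S T = Sum.map (#ante S ↑ʳ_) (#succ S ↑ʳ_)

locate : {A : Set} (U V : Seqt A) {S : Seqt A} → S ≋ U ⊕ V → Occ S → Occ U ⊎ Occ V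
locate U V e μ = split U V (move e μ)

≋-refl : {A : Set} {S : Seqt A} → S ≋ S
≋-refl = (Perm.id , λ _ → refl) , (Perm.id , λ _ → refl)

≋-trans : {A : Set} {S T U : Seqt A} → S ≋ T → T ≋ U → S ≋ U
≋-trans ((p , p≡) , (q , q≡)) ((p′ , p′≡) , (q′ , q′≡)) =
  (p′ Perm.∘ₚ p , λ i → trans (p≡ _) (p′≡ i)) ,
  (q′ Perm.∘ₚ q , λ i → trans (q≡ _) (q′≡ i))

mapˢ-≋ : {A B : Set} (f : A → B) {S T : Seqt A} → S ≋ T → mapˢ f S ≋ mapˢ f T
mapˢ-≋ {A} f {S} {T} ((p , p≡) , (q , q≡)) =
  (p , λ i → map-≡ (ante S) (ante T) (p≡ i)) , (q , λ i → map-≡ (succ S) (succ T) (q≡ i))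
  where
  map-≡ : ∀ {m n} (xs : Vec A m) (ys : Vec A n) {i j} → lookup xs i ≡ lookup ys j →
          lookup (Vec.map f xs) i ≡ lookup (Vec.map f ys) j
  map-≡ xs ys {i} {j} x≡y =
    trans (Vecₚ.lookup-map i f xs) (trans (cong f x≡y) (sym (Vecₚ.lookup-map j f ys)))

≋-resp : {A : Set} {S : Seqt A} {m n : ℕ} {Γ Γ′ : Vec A m} {Δ Δ′ : Vec A n} →
         Γ ≡ Γ′ → Δ ≡ Δ′ → S ≋ (Γ ⊢ Δ) → S ≋ (Γ′ ⊢ Δ′)
≋-resp Γ≡ Δ≡ ((p , p≡) , (q , q≡)) =
  (p , λ i → trans (p≡ i) (cong (λ v → lookup v i) Γ≡)) ,
  (q , λ i → trans (q≡ i) (cong (λ v → lookup v i) Δ≡))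

mapˢ-≋-⊕ : {A B : Set} (f : A → B) (U V : Seqt A) {S : Seqt A} →
           S ≋ U ⊕ V → mapˢ f S ≋ mapˢ f U ⊕ mapˢ f V
mapˢ-≋-⊕ f (Γ ⊢ Δ) (Γ′ ⊢ Δ′) e =
  ≋-resp (Vecₚ.map-++ f Γ Γ′) (Vecₚ.map-++ f Δ Δ′) (mapˢ-≋ f e)

mapˢ-≋-⊕-⊕ : {A B : Set} (f : A → B) (U V W : Seqt A) {S : Seqt A} →
             S ≋ U ⊕ V ⊕ W → mapˢ f S ≋ mapˢ f U ⊕ mapˢ f V ⊕ mapˢ f W
mapˢ-≋-⊕-⊕ f U@(Γ ⊢ Δ) V@(Γ′ ⊢ Δ′) W@(Γ″ ⊢ Δ″) e =
  ≋-resp (cong (Vec.map f Γ Vec.++_) (Vecₚ.map-++ f Γ′ Γ″))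
         (cong (Vec.map f Δ Vec.++_) (Vecₚ.map-++ f Δ′ Δ″))
         (mapˢ-≋-⊕ f U (V ⊕ W) e)

------------------------------------------------------------------------

data Cmp : Set where
  eq lt gt le ge : Cmp

compareᵇ : Cmp → ℕ → ℕ → Bool
compareᵇ eq a b = a ≡ᵇ b
compareᵇ lt a b = a <ᵇ b
compareᵇ gt a b = b <ᵇ a
compareᵇ le a b = a ≤ᵇ b
compareᵇ ge a b = b ≤ᵇ a

data Quantifier : Set where
  ∀q ∃q : Quantifier

------------------------------------------------------------------------

record Language : Set₁ where
  field
    Par  : Set
    _≟_  : DecidableEquality Par
    FVar : Set
    Fun  : Set
    arᶠ  : Fun → ℕ
    Pred : Set          -- the predicate symbols other than =, <, >, ≤, ≥
    arᵖ  : Pred → ℕ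

module Schemata (L : Language) where

  open Language L public

  ----------------------------------------------------------------------
  -- Terms.  Term n is the set of semi-terms whose bound variables are the
  -- de Bruijn indices in Fin n; Term 0 is the set of terms.  Parameter-free
  -- terms over 0, s, p are identified with their values, so the semi-terms
  -- are given in canonical form: a semi-term is a numeral or else contains
  -- no parameter-free subterm over 0, s, p other than numerals.  In particular
  -- p(s(x)) is not simplified when x is a variable.

  data Term (n : ℕ) : Set
  data NonNumeral (n : ℕ) : Set

  data Term n where
    num : ℕ → Term n
    ⌈_⌉ : NonNumeral n → Term n

  data NonNumeral n where
    par  : Par → NonNumeral n
    fvar : FVar → NonNumeral n
    bvar : Fin n → NonNumeral n
    sᵒ   : NonNumeral n → NonNumeral n
    pᵒ   : NonNumeral n → NonNumeral n
    fn   : (f : Fun) → Vec (Term n) (arᶠ f) → NonNumeral n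

  s p : ∀ {n} → Term n → Term n
  s (num k) = num (suc k)
  s ⌈ t ⌉   = ⌈ sᵒ t ⌉
  p (num k) = num (pred k)
  p ⌈ t ⌉   = ⌈ pᵒ t ⌉

  data T₀ : Set where
    par₀  : Par → T₀
    zero₀ : T₀
    s₀ p₀ : T₀ → T₀

  ⌜_⌝ : T₀ → ∀ {n} → Term n
  ⌜ par₀ m ⌝ = ⌈ par m ⌉
  ⌜ zero₀ ⌝  = num 0
  ⌜ s₀ u ⌝   = s ⌜ u ⌝
  ⌜ p₀ u ⌝   = p ⌜ u ⌝

  numeral : ℕ → T₀
  numeral zero    = zero₀
  numeral (suc k) = s₀ (numeral k)

  ----------------------------------------------------------------------
  -- Formulas, with quantifiers binding de Bruijn index 0; Form 0 is the set
  -- of 𝒩-formulas.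

  data Atom (n : ℕ) : Set where
    cmp  : Cmp → Term n → Term n → Atom n
    rel  : (P : Pred) → Vec (Term n) (arᵖ P) → Atom n

  infix  9 ~_
  infixr 7 _∧ᶠ_
  infixr 6 _∨ᶠ_
  infixr 5 _⇒ᶠ_

  data Form (n : ℕ) : Set where
    atom  : Atom n → Form n
    ~_    : Form n → Form n
    _∧ᶠ_  : Form n → Form n → Form n
    _∨ᶠ_  : Form n → Form n → Form n
    _⇒ᶠ_  : Form n → Form n → Form n
    quant : Quantifier → Form (suc n) → Form n

  Sequent : Set
  Sequent = Seqt (Form 0)

  quants : Quantifier → ∀ {β} → Form β → Form 0
  quants q {zero}  A = A
  quants q {suc β} A = quants q (quant q A)

  QF : ∀ {n} → Form n → Set
  QF (atom _)    = ⊤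
  QF (~ A)       = QF A
  QF (A ∧ᶠ B)    = QF A × QF B
  QF (A ∨ᶠ B)    = QF A × QF B
  QF (A ⇒ᶠ B)    = QF A × QF B
  QF (quant _ _) = ⊥

  data Prenex {n : ℕ} : Form n → Set where
    matrix : ∀ {A} → QF A → Prenex A
    prefix : ∀ {q A} → Prenex A → Prenex (quant q A)

  NoStrong : Sign → ∀ {n} → Form n → Set
  NoStrong π (atom _)              = ⊤
  NoStrong π (~ A)                 = NoStrong (opposite π) A
  NoStrong π (A ∧ᶠ B)              = NoStrong π A × NoStrong π B
  NoStrong π (A ∨ᶠ B)              = NoStrong π A × NoStrong π B
  NoStrong π (A ⇒ᶠ B)              = NoStrong (opposite π) A × NoStrong π B
  NoStrong Sign.+ (quant ∀q A)     = ⊥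
  NoStrong Sign.+ (quant ∃q A)     = NoStrong Sign.+ A
  NoStrong Sign.- (quant ∀q A)     = NoStrong Sign.- A
  NoStrong Sign.- (quant ∃q A)     = ⊥

  Skolemized : Sequent → Set
  Skolemized S = All (NoStrong Sign.-) (ante S) × All (NoStrong Sign.+) (succ S)

  PrenexSequent : Sequent → Set
  PrenexSequent S = ∀ μ → Prenex (S at μ)

  ----------------------------------------------------------------------
  -- Occurrence of parameters (inj₁) and free variables (inj₂)

  Var : Set
  Var = Par ⊎ FVar

  mutual
    Occursᵗ : ∀ {n} → Var → Term n → Set
    Occursᵗ v (num _) = ⊥
    Occursᵗ v ⌈ t ⌉   = Occursᵒ v t

    Occursᵒ : ∀ {n} → Var → NonNumeral n → Set
    Occursᵒ v (par m)   = v ≡ inj₁ m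
    Occursᵒ v (fvar y)  = v ≡ inj₂ y
    Occursᵒ v (bvar _)  = ⊥
    Occursᵒ v (sᵒ t)    = Occursᵒ v t
    Occursᵒ v (pᵒ t)    = Occursᵒ v t
    Occursᵒ v (fn _ ts) = Occursᵛ v ts

    Occursᵛ : ∀ {n k} → Var → Vec (Term n) k → Set
    Occursᵛ v []       = ⊥
    Occursᵛ v (t ∷ ts) = Occursᵗ v t ⊎ Occursᵛ v ts

  Occursᵃ : ∀ {n} → Var → Atom n → Set
  Occursᵃ v (cmp _ t u)  = Occursᵗ v t ⊎ Occursᵗ v u
  Occursᵃ v (rel _ ts)   = Occursᵛ v ts

  Occurs : ∀ {n} → Var → Form n → Set
  Occurs v (atom A)    = Occursᵃ v A
  Occurs v (~ A)       = Occurs v A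
  Occurs v (A ∧ᶠ B)    = Occurs v A ⊎ Occurs v B
  Occurs v (A ∨ᶠ B)    = Occurs v A ⊎ Occurs v B
  Occurs v (A ⇒ᶠ B)    = Occurs v A ⊎ Occurs v B
  Occurs v (quant _ A) = Occurs v A

  Occursˢ : Var → Sequent → Set
  Occursˢ v S = ∃[ μ ] Occurs v (S at μ)

  ----------------------------------------------------------------------

  mutual
    subᵗ : ∀ {m n} → (Fin m → Term n) → Term m → Term n
    subᵗ τ (num k) = num k
    subᵗ τ ⌈ t ⌉   = subᵒ τ t

    subᵒ : ∀ {m n} → (Fin m → Term n) → NonNumeral m → Term n
    subᵒ τ (par m)   = ⌈ par m ⌉
    subᵒ τ (fvar y)  = ⌈ fvar y ⌉
    subᵒ τ (bvar i)  = τ i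
    subᵒ τ (sᵒ t)    = s (subᵒ τ t)
    subᵒ τ (pᵒ t)    = p (subᵒ τ t)
    subᵒ τ (fn f ts) = ⌈ fn f (subᵛ τ ts) ⌉

    subᵛ : ∀ {m n k} → (Fin m → Term n) → Vec (Term m) k → Vec (Term n) k
    subᵛ τ []       = []
    subᵛ τ (t ∷ ts) = subᵗ τ t ∷ subᵛ τ ts

  lift : ∀ {m n} → (Fin m → Term n) → Fin (suc m) → Term (suc n)
  lift τ zero    = ⌈ bvar zero ⌉
  lift τ (suc i) = subᵗ (λ j → ⌈ bvar (suc j) ⌉) (τ i)

  subᵃ : ∀ {m n} → (Fin m → Term n) → Atom m → Atom n
  subᵃ τ (cmp c t u) = cmp c (subᵗ τ t) (subᵗ τ u)
  subᵃ τ (rel P ts)  = rel P (subᵛ τ ts)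

  sub : ∀ {m n} → (Fin m → Term n) → Form m → Form n
  sub τ (atom A)    = atom (subᵃ τ A)
  sub τ (~ A)       = ~ sub τ A
  sub τ (A ∧ᶠ B)    = sub τ A ∧ᶠ sub τ B
  sub τ (A ∨ᶠ B)    = sub τ A ∨ᶠ sub τ B
  sub τ (A ⇒ᶠ B)    = sub τ A ⇒ᶠ sub τ B
  sub τ (quant q A) = quant q (sub (lift τ) A)

  -- Let F = Q x₁ … Q x_β F′.  Index 0 of F′ : Form β is the innermost variable
  -- x_β and index β - 1 is x₁.  A substitution {x₁ ← t₁, …, x_i ← t_i} is the
  -- vector (t_i , … , t₁), which is the final segment of a vector of length
  -- β = k + i.  Hence {x₁ ← t₁, …, x_i ← t_i} η is η Vec.++ (t_i , … , t₁).

  _⟦_⟧ : ∀ {β} → Form β → Vec (Term 0) β → Form 0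
  F′ ⟦ θ ⟧ = sub (lookup θ) F′

  partially : ∀ k {i} → Form (k + i) → Vec (Term 0) i → Form k
  partially k F′ θ =
    sub (λ x → [ (λ j → ⌈ bvar j ⌉) , (λ j → subᵗ (λ ()) (lookup θ j)) ]′ (splitAt k x)) F′

  ----------------------------------------------------------------------

  ParSub : Set
  ParSub = Par → T₀

  Assignment : Set
  Assignment = Par → ℕ

  mutual
    psubᵗ : ∀ {n} → ParSub → Term n → Term n
    psubᵗ θ (num k) = num k
    psubᵗ θ ⌈ t ⌉   = psubᵒ θ t

    psubᵒ : ∀ {n} → ParSub → NonNumeral n → Term n
    psubᵒ θ (par m)   = ⌜ θ m ⌝
    psubᵒ θ (fvar y)  = ⌈ fvar y ⌉
    psubᵒ θ (bvar i)  = ⌈ bvar i ⌉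
    psubᵒ θ (sᵒ t)    = s (psubᵒ θ t)
    psubᵒ θ (pᵒ t)    = p (psubᵒ θ t)
    psubᵒ θ (fn f ts) = ⌈ fn f (psubᵛ θ ts) ⌉

    psubᵛ : ∀ {n k} → ParSub → Vec (Term n) k → Vec (Term n) k
    psubᵛ θ []       = []
    psubᵛ θ (t ∷ ts) = psubᵗ θ t ∷ psubᵛ θ ts

  psubᵃ : ∀ {n} → ParSub → Atom n → Atom n
  psubᵃ θ (cmp c t u) = cmp c (psubᵗ θ t) (psubᵗ θ u)
  psubᵃ θ (rel P ts)  = rel P (psubᵛ θ ts)

  psub : ∀ {n} → ParSub → Form n → Form n
  psub θ (atom A)    = atom (psubᵃ θ A)
  psub θ (~ A)       = ~ psub θ A
  psub θ (A ∧ᶠ B)    = psub θ A ∧ᶠ psub θ B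
  psub θ (A ∨ᶠ B)    = psub θ A ∨ᶠ psub θ B
  psub θ (A ⇒ᶠ B)    = psub θ A ⇒ᶠ psub θ B
  psub θ (quant q A) = quant q (psub θ A)

  value : Assignment → T₀ → ℕ
  value σ (par₀ m) = σ m
  value σ zero₀    = 0
  value σ (s₀ u)   = suc (value σ u)
  value σ (p₀ u)   = pred (value σ u)

  asParSub : Assignment → ParSub
  asParSub σ m = numeral (σ m)

  applyᵗ : ∀ {n} → Assignment → Term n → Term n
  applyᵗ σ = psubᵗ (asParSub σ)

  apply : ∀ {n} → Assignment → Form n → Form n
  apply σ = psub (asParSub σ)

  applyˢ : Assignment → Sequent → Sequent
  applyˢ σ = mapˢ (apply σ)

  _∘ₚ_ : Assignment → ParSub → Assignment
  (σ ∘ₚ θ) m = value σ (θ m)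

  ⟨_←_⟩ : ∀ {r} → Vec Par r → Vec T₀ r → ParSub
  ⟨ ks ← us ⟩ m with any? (λ i → lookup ks i ≟ m)
  ... | yes (i , _) = lookup us i
  ... | no  _       = par₀ m

  ⟨←⟩-lookup : ∀ {r} {ks : Vec Par r} {us : Vec T₀ r} → Unique ks →
               ∀ i → ⟨ ks ← us ⟩ (lookup ks i) ≡ lookup us i
  ⟨←⟩-lookup {ks = ks} {us} unique i with any? (λ j → lookup ks j ≟ lookup ks i)
  ... | yes (j , kⱼ≡kᵢ) = cong (lookup us) (lookup-injective unique j i kⱼ≡kᵢ)
  ... | no  k≢          = contradiction (i , refl) k≢

  ----------------------------------------------------------------------

  data Cond : Set where
    ⊤ᶜ ⊥ᶜ     : Cond
    -- s^α(v) △ s^β(0)  and  s^α(v) △ s^β(w)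
    cmpNum    : (α : ℕ) (v : Par) → Cmp → (β : ℕ) → Cond
    cmpPar    : (α : ℕ) (v : Par) → Cmp → (β : ℕ) (w : Par) → v ≢ w → Cond
    ¬ᶜ_       : Cond → Cond
    _∧ᶜ_ _∨ᶜ_ : Cond → Cond → Cond

  truth : Assignment → Cond → Bool
  truth σ ⊤ᶜ                   = true
  truth σ ⊥ᶜ                   = false
  truth σ (cmpNum α v c β)     = compareᵇ c (α + σ v) β
  truth σ (cmpPar α v c β w _) = compareᵇ c (α + σ v) (β + σ w)
  truth σ (¬ᶜ C)               = not (truth σ C)
  truth σ (C ∧ᶜ D)             = truth σ C ∧ truth σ D
  truth σ (C ∨ᶜ D)             = truth σ C ∨ truth σ D

  infix 4 _⊨_

  _⊨_ : Assignment → Cond → Set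
  σ ⊨ C = truth σ C ≡ true

  IsPartition : ∀ {k} → (Fin k → Cond) → Set
  IsPartition C = ∀ σ → ∃! _≡_ (λ j → σ ⊨ C j)

  ----------------------------------------------------------------------

  -- First-order structures.  The symbols 0, s, p and <, >, ≤, ≥ are not
  -- interpreted in any special way; parameters and free variables are both
  -- assigned elements of the domain.

  record Structure : Set₁ where
    field
      D    : Set
      0ᴰ   : D
      sᴰ   : D → D
      pᴰ   : D → D
      funᴰ : (f : Fun) → Vec D (arᶠ f) → D
      ltᴰ gtᴰ leᴰ geᴰ : D → D → Set
      relᴰ : (P : Pred) → Vec D (arᵖ P) → Set
      varᴰ : Var → D

  module _ (M : Structure) where
    open Structure M

    numᴰ : ℕ → D
    numᴰ zero    = 0ᴰ
    numᴰ (suc k) = sᴰ (numᴰ k)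

    mutual
      interpretᵗ : Term 0 → D
      interpretᵗ (num k) = numᴰ k
      interpretᵗ ⌈ t ⌉   = interpretᵒ t

      interpretᵒ : NonNumeral 0 → D
      interpretᵒ (par m)   = varᴰ (inj₁ m)
      interpretᵒ (fvar y)  = varᴰ (inj₂ y)
      interpretᵒ (sᵒ t)    = sᴰ (interpretᵒ t)
      interpretᵒ (pᵒ t)    = pᴰ (interpretᵒ t)
      interpretᵒ (fn f ts) = funᴰ f (interpretᵛ ts)

      interpretᵛ : ∀ {k} → Vec (Term 0) k → Vec D k
      interpretᵛ []       = []
      interpretᵛ (t ∷ ts) = interpretᵗ t ∷ interpretᵛ ts

    compareᴰ : Cmp → D → D → Set
    compareᴰ eq = _≡_
    compareᴰ lt = ltᴰ
    compareᴰ gt = gtᴰ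
    compareᴰ le = leᴰ
    compareᴰ ge = geᴰ

    Holds : Atom 0 → Set
    Holds (cmp c t u) = compareᴰ c (interpretᵗ t) (interpretᵗ u)
    Holds (rel P ts)  = relᴰ P (interpretᵛ ts)

  Tautological : Seqt (Atom 0) → Set
  Tautological 𝒜 = ∃[ A ] A VecMem.∈ ante 𝒜 × A VecMem.∈ succ 𝒜

  -- Classical validity: no structure refutes the sequent.

  Valid : Seqt (Atom 0) → Set₁
  Valid 𝒜 = ∀ M → ¬ (All (Holds M) (ante 𝒜) × All (¬_ ∘ Holds M) (succ 𝒜))

  Comparison : Set
  Comparison = Cmp × T₀ × T₀

  comparison : Comparison → Form 0
  comparison (c , u , v) = atom (cmp c ⌜ u ⌝ ⌜ v ⌝)

  True : Assignment → Comparison → Set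
  True σ (c , u , v) = compareᵇ c (value σ u) (value σ v) ≡ true

  Entails : Cond → Seqt Comparison → Set
  Entails C 𝒞 = ∀ σ → σ ⊨ C → All (True σ) (ante 𝒞) → Any (True σ) (succ 𝒞)

  data Axiom (C : Cond) (S : Sequent) : Set₁ where
    tautology : (𝒜 : Seqt (Atom 0)) → S ≋ mapˢ atom 𝒜 → Tautological 𝒜 → Axiom C S
    equality  : (𝒜 : Seqt (Atom 0)) → S ≋ mapˢ atom 𝒜 → Valid 𝒜 → Axiom C S
    condition : (𝒞 : Seqt Comparison) → S ≋ mapˢ comparison 𝒞 → Entails C 𝒞 → Axiom C S

  ----------------------------------------------------------------------
  -- The calculus.  A rule is given by its context, its auxiliary formulas
  -- (as the sequents they form in the premises) and its principal formula
  -- (likewise in the conclusion).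

  ∅ : Sequent
  ∅ = [] ⊢ []

  infix 4 _⊢∅ ∅⊢_ _⊢¹_

  _⊢∅ ∅⊢_ : Form 0 → Sequent
  A ⊢∅ = (A ∷ []) ⊢ []
  ∅⊢ A = [] ⊢ (A ∷ [])

  _⊢¹_ : Form 0 → Form 0 → Sequent
  A ⊢¹ B = (A ∷ []) ⊢ (B ∷ [])

  _∉ˢ_ : FVar → Sequent → Set
  y ∉ˢ S = ¬ Occursˢ (inj₂ y) S

  data Unary (Γ : Sequent) : (aux principal : Sequent) → Set where
    weakenˡ   : ∀ A → Unary Γ ∅ (A ⊢∅)
    weakenʳ   : ∀ A → Unary Γ ∅ (∅⊢ A)
    contractˡ : ∀ A → Unary Γ ((A ∷ A ∷ []) ⊢ []) (A ⊢∅)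
    contractʳ : ∀ A → Unary Γ ([] ⊢ (A ∷ A ∷ [])) (∅⊢ A)
    ¬ˡ        : ∀ A → Unary Γ (∅⊢ A) (~ A ⊢∅)
    ¬ʳ        : ∀ A → Unary Γ (A ⊢∅) (∅⊢ ~ A)
    ∧ˡ₁       : ∀ A B → Unary Γ (A ⊢∅) (A ∧ᶠ B ⊢∅)
    ∧ˡ₂       : ∀ A B → Unary Γ (B ⊢∅) (A ∧ᶠ B ⊢∅)
    ∨ʳ₁       : ∀ A B → Unary Γ (∅⊢ A) (∅⊢ A ∨ᶠ B)
    ∨ʳ₂       : ∀ A B → Unary Γ (∅⊢ B) (∅⊢ A ∨ᶠ B)
    →ʳ        : ∀ A B → Unary Γ (A ⊢¹ B) (∅⊢ A ⇒ᶠ B)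
    ∀ˡ        : ∀ A t → Unary Γ (A ⟦ t ∷ [] ⟧ ⊢∅) (quant ∀q A ⊢∅)
    ∃ʳ        : ∀ A t → Unary Γ (∅⊢ A ⟦ t ∷ [] ⟧) (∅⊢ quant ∃q A)
    ∀ʳ        : ∀ A y → y ∉ˢ Γ → y ∉ˢ (∅⊢ quant ∀q A) →
                Unary Γ (∅⊢ A ⟦ ⌈ fvar y ⌉ ∷ [] ⟧) (∅⊢ quant ∀q A)
    ∃ˡ        : ∀ A y → y ∉ˢ Γ → y ∉ˢ (quant ∃q A ⊢∅) →
                Unary Γ (A ⟦ ⌈ fvar y ⌉ ∷ [] ⟧ ⊢∅) (quant ∃q A ⊢∅)

  data Binary : (aux₁ aux₂ principal : Sequent) → Set where
    ∧ʳ  : ∀ A B → Binary (∅⊢ A) (∅⊢ B) (∅⊢ A ∧ᶠ B)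
    ∨ˡ  : ∀ A B → Binary (A ⊢∅) (B ⊢∅) (A ∨ᶠ B ⊢∅)
    →ˡ  : ∀ A B → Binary (∅⊢ A) (B ⊢∅) (A ⇒ᶠ B ⊢∅)
    cut : ∀ A → Binary (∅⊢ A) (A ⊢∅) ∅

  -- The conversions _≋_ in the inferences express that sequents are multisets.

  data Deriv (Ax : Sequent → Set₁) (Call : Sequent → Set) : Sequent → Set₁ where
    axiom  : ∀ {S} → Ax S → Deriv Ax Call S
    call   : ∀ {S} → Call S → Deriv Ax Call S
    unary  : ∀ {Γ A P S T} → Unary Γ A P → S ≋ P ⊕ Γ → T ≋ A ⊕ Γ →
             Deriv Ax Call T → Deriv Ax Call S
    binary : ∀ {Γ₁ Γ₂ A₁ A₂ P S T₁ T₂} → Binary A₁ A₂ P →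
             S ≋ P ⊕ Γ₁ ⊕ Γ₂ → T₁ ≋ A₁ ⊕ Γ₁ → T₂ ≋ A₂ ⊕ Γ₂ →
             Deriv Ax Call T₁ → Deriv Ax Call T₂ → Deriv Ax Call S

  module _ {Ax : Sequent → Set₁} {Call : Sequent → Set} where

    QFCuts : ∀ {S} → Deriv Ax Call S → Set
    QFCuts (axiom _)                    = ⊤
    QFCuts (call _)                     = ⊤
    QFCuts (unary _ _ _ d)              = QFCuts d
    QFCuts (binary (cut A) _ _ _ d₁ d₂) = QF A × QFCuts d₁ × QFCuts d₂
    QFCuts (binary _ _ _ _ d₁ d₂)       = QFCuts d₁ × QFCuts d₂

    OccursInDeriv : Var → ∀ {S} → Deriv Ax Call S → Set
    OccursInDeriv v {S} (axiom _)              = Occursˢ v S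
    OccursInDeriv v {S} (call _)               = Occursˢ v S
    OccursInDeriv v {S} (unary _ _ _ d)        = Occursˢ v S ⊎ OccursInDeriv v d
    OccursInDeriv v {S} (binary _ _ _ _ d₁ d₂) = Occursˢ v S ⊎ OccursInDeriv v d₁ ⊎ OccursInDeriv v d₂

    data CallsIn : ∀ {S} → Deriv Ax Call S → ∀ {T} → Call T → Set₁ where
      here  : ∀ {S} {c : Call S} → CallsIn (call c) c
      up    : ∀ {Γ A P S T U} {r : Unary Γ A P} {e : S ≋ P ⊕ Γ} {e′ : T ≋ A ⊕ Γ}
              {d : Deriv Ax Call T} {c : Call U} →
              CallsIn d c → CallsIn (unary r e e′ d) c
      left  : ∀ {Γ₁ Γ₂ A₁ A₂ P S T₁ T₂ U} {r : Binary A₁ A₂ P}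
              {e : S ≋ P ⊕ Γ₁ ⊕ Γ₂} {e₁ : T₁ ≋ A₁ ⊕ Γ₁} {e₂ : T₂ ≋ A₂ ⊕ Γ₂}
              {d₁ : Deriv Ax Call T₁} {d₂ : Deriv Ax Call T₂} {c : Call U} →
              CallsIn d₁ c → CallsIn (binary r e e₁ e₂ d₁ d₂) c
      right : ∀ {Γ₁ Γ₂ A₁ A₂ P S T₁ T₂ U} {r : Binary A₁ A₂ P}
              {e : S ≋ P ⊕ Γ₁ ⊕ Γ₂} {e₁ : T₁ ≋ A₁ ⊕ Γ₁} {e₂ : T₂ ≋ A₂ ⊕ Γ₂}
              {d₁ : Deriv Ax Call T₁} {d₂ : Deriv Ax Call T₂} {c : Call U} →
              CallsIn d₂ c → CallsIn (binary r e e₁ e₂ d₁ d₂) c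

    --------------------------------------------------------------------

    -- Immediate ancestors, from an occurrence μ in a conclusion S ≋ P ⊕ Γ to an
    -- occurrence ν in a premise T ≋ A ⊕ Δ whose context Δ is included in Γ by ι:
    -- all auxiliary formulas are ancestors of the principal formula (there is
    -- at most one), and a context formula is its own ancestor.

    data Ancestor {P A Γ Δ S T : Sequent} (ι : Occ Δ → Occ Γ)
                  (e : S ≋ P ⊕ Γ) (e′ : T ≋ A ⊕ Δ) (μ : Occ S) (ν : Occ T) : Set where
      principal : ∀ {a b} → locate P Γ e μ ≡ inj₁ a → locate A Δ e′ ν ≡ inj₁ b → Ancestor ι e e′ μ ν
      context   : ∀ {c} → locate P Γ e μ ≡ inj₂ (ι c) → locate A Δ e′ ν ≡ inj₂ c → Ancestor ι e e′ μ ν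

    -- Path d μ d′ ν: following immediate ancestors upwards from the occurrence
    -- μ in the end-sequent of d leads to ν in the end-sequent of the subproof d′.
    -- Traces are the paths for which d′ is an initial sequent.

    data Path : ∀ {S} (d : Deriv Ax Call S) (μ : Occ S)
                {U} (d′ : Deriv Ax Call U) (ν : Occ U) → Set₁ where
      stop  : ∀ {S} {d : Deriv Ax Call S} {μ} → Path d μ d μ
      up    : ∀ {Γ A P S T U} {r : Unary Γ A P} {e : S ≋ P ⊕ Γ} {e′ : T ≋ A ⊕ Γ}
              {d : Deriv Ax Call T} {μ κ} {d′ : Deriv Ax Call U} {ν} →
              Ancestor {P} {A} {Γ} id e e′ μ κ → Path d κ d′ ν → Path (unary r e e′ d) μ d′ ν
      left  : ∀ {Γ₁ Γ₂ A₁ A₂ P S T₁ T₂ U} {r : Binary A₁ A₂ P}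
              {e : S ≋ P ⊕ Γ₁ ⊕ Γ₂} {e₁ : T₁ ≋ A₁ ⊕ Γ₁} {e₂ : T₂ ≋ A₂ ⊕ Γ₂}
              {d₁ : Deriv Ax Call T₁} {d₂ : Deriv Ax Call T₂}
              {μ κ} {d′ : Deriv Ax Call U} {ν} →
              Ancestor {P} {A₁} (inˡ Γ₁ Γ₂) e e₁ μ κ → Path d₁ κ d′ ν →
              Path (binary r e e₁ e₂ d₁ d₂) μ d′ ν
      right : ∀ {Γ₁ Γ₂ A₁ A₂ P S T₁ T₂ U} {r : Binary A₁ A₂ P}
              {e : S ≋ P ⊕ Γ₁ ⊕ Γ₂} {e₁ : T₁ ≋ A₁ ⊕ Γ₁} {e₂ : T₂ ≋ A₂ ⊕ Γ₂}
              {d₁ : Deriv Ax Call T₁} {d₂ : Deriv Ax Call T₂}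
              {μ κ} {d′ : Deriv Ax Call U} {ν} →
              Ancestor {P} {A₂} (inʳ Γ₁ Γ₂) e e₂ μ κ → Path d₂ κ d′ ν →
              Path (binary r e e₁ e₂ d₁ d₂) μ d′ ν

    yield : ∀ {S U} {d : Deriv Ax Call S} {μ} {d′ : Deriv Ax Call U} {ν} → Path d μ d′ ν → List (Form 0)
    yield {S} {μ = μ} stop        = S at μ ∷ []
    yield {S} {μ = μ} (up _ π)    = S at μ ∷ yield π
    yield {S} {μ = μ} (left _ π)  = S at μ ∷ yield π
    yield {S} {μ = μ} (right _ π) = S at μ ∷ yield π

    -- The instances chosen by the quantifier inferences whose principal formula
    -- the path goes through, outermost quantifier last (as in substitutions).

    instance-term : ∀ {Γ A P} → Unary Γ A P → Maybe (Term 0)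
    instance-term (∀ˡ _ t)     = just t
    instance-term (∃ʳ _ t)     = just t
    instance-term (∀ʳ _ y _ _) = just ⌈ fvar y ⌉
    instance-term (∃ˡ _ y _ _) = just ⌈ fvar y ⌉
    instance-term _            = nothing

    instances : ∀ {S U} {d : Deriv Ax Call S} {μ} {d′ : Deriv Ax Call U} {ν} → Path d μ d′ ν → List (Term 0)
    instances stop = []
    instances (up {r = r} (principal _ _) π) with instance-term r
    ... | just t  = instances π ∷ʳ t
    ... | nothing = instances π
    instances (up (context _ _) π) = instances π
    instances (left _ π)           = instances π
    instances (right _ π)          = instances π

    infix 4 _⊑_

    data _⊑_ {n : ℕ} : Form n → Form n → Set where
      ⊑-refl : ∀ {A} → A ⊑ A
      ⊑-~    : ∀ {G A} → G ⊑ A → G ⊑ ~ A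
      ⊑-∧₁   : ∀ {G A B} → G ⊑ A → G ⊑ A ∧ᶠ B
      ⊑-∧₂   : ∀ {G A B} → G ⊑ B → G ⊑ A ∧ᶠ B
      ⊑-∨₁   : ∀ {G A B} → G ⊑ A → G ⊑ A ∨ᶠ B
      ⊑-∨₂   : ∀ {G A B} → G ⊑ B → G ⊑ A ∨ᶠ B
      ⊑-⇒₁   : ∀ {G A B} → G ⊑ A → G ⊑ A ⇒ᶠ B
      ⊑-⇒₂   : ∀ {G A B} → G ⊑ B → G ⊑ A ⇒ᶠ B

    -- Hi q F′ τ θ: hi(τ) = θ, for a trace τ of an occurrence of quants q F′.
    -- The condition on instances makes hi(τ) unique, also when F′ does not
    -- contain all of the variables x₁, …, x_β.

    data Hi (q : Quantifier) {S} {d : Deriv Ax Call S} {μ : Occ S} :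
            ∀ {β} → Form β → ∀ {U} {d′ : Deriv Ax Call U} {ν} → Path d μ d′ ν →
            ∀ {i} → Vec (Term 0) i → Set₁ where

      atAxiom : ∀ {β} {F′ : Form β} {U} {a : Ax U} {ν} {τ : Path d μ (axiom a) ν} {θ : Vec (Term 0) β} →
              Vec.toList θ ≡ instances τ → F′ ⟦ θ ⟧ ∈ yield τ → Hi q F′ τ θ

      untouched : ∀ {β} {F′ : Form β} {U} {c : Call U} {ν} {τ : Path d μ (call c) ν} →
                  [] ≡ instances τ → U at ν ≡ quants q F′ → Hi q F′ τ []

      partial : ∀ {k i} {F′ : Form (k + i)} {U} {c : Call U} {ν} {τ : Path d μ (call c) ν}
                {θ : Vec (Term 0) i} → 1 ≤ k → 1 ≤ i →
                Vec.toList θ ≡ instances τ → U at ν ≡ quants q (partially k F′ θ) → Hi q F′ τ θ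

      complete : ∀ {β} {F′ : Form β} {U} {c : Call U} {ν} {τ : Path d μ (call c) ν} {θ : Vec (Term 0) β} →
                 Vec.toList θ ≡ instances τ → F′ ⟦ θ ⟧ ∈ yield τ → U at ν ⊑ F′ ⟦ θ ⟧ → Hi q F′ τ θ

  ----------------------------------------------------------------------

  psub-s : ∀ {n} (θ : ParSub) (t : Term n) → psubᵗ θ (s t) ≡ s (psubᵗ θ t)
  psub-s θ (num k) = refl
  psub-s θ ⌈ t ⌉   = refl

  psub-p : ∀ {n} (θ : ParSub) (t : Term n) → psubᵗ θ (p t) ≡ p (psubᵗ θ t)
  psub-p θ (num k) = refl
  psub-p θ ⌈ t ⌉   = refl

  sub-s : ∀ {m n} (τ : Fin m → Term n) (t : Term m) → subᵗ τ (s t) ≡ s (subᵗ τ t)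
  sub-s τ (num k) = refl
  sub-s τ ⌈ t ⌉   = refl

  sub-p : ∀ {m n} (τ : Fin m → Term n) (t : Term m) → subᵗ τ (p t) ≡ p (subᵗ τ t)
  sub-p τ (num k) = refl
  sub-p τ ⌈ t ⌉   = refl

  ⌜numeral⌝ : ∀ k {n} → ⌜ numeral k ⌝ {n} ≡ num k
  ⌜numeral⌝ zero    = refl
  ⌜numeral⌝ (suc k) = cong s (⌜numeral⌝ k)

  sub-⌜⌝ : ∀ {m n} (τ : Fin m → Term n) (u : T₀) → subᵗ τ ⌜ u ⌝ ≡ ⌜ u ⌝
  sub-⌜⌝ τ (par₀ m) = refl
  sub-⌜⌝ τ zero₀    = refl
  sub-⌜⌝ τ (s₀ u)   = trans (sub-s τ ⌜ u ⌝) (cong s (sub-⌜⌝ τ u))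
  sub-⌜⌝ τ (p₀ u)   = trans (sub-p τ ⌜ u ⌝) (cong p (sub-⌜⌝ τ u))

  psub-⌜⌝ : ∀ (σ : Assignment) (u : T₀) {n} → psubᵗ (asParSub σ) (⌜ u ⌝ {n}) ≡ ⌜ numeral (value σ u) ⌝
  psub-⌜⌝ σ (par₀ m) = refl
  psub-⌜⌝ σ zero₀    = refl
  psub-⌜⌝ σ (s₀ u)   = trans (psub-s _ ⌜ u ⌝) (cong s (psub-⌜⌝ σ u))
  psub-⌜⌝ σ (p₀ u)   = begin
    psubᵗ (asParSub σ) (p ⌜ u ⌝)   ≡⟨ psub-p _ ⌜ u ⌝ ⟩
    p (psubᵗ (asParSub σ) ⌜ u ⌝)   ≡⟨ cong p (psub-⌜⌝ σ u) ⟩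
    p ⌜ numeral (value σ u) ⌝      ≡⟨ cong p (⌜numeral⌝ (value σ u)) ⟩
    num (pred (value σ u))         ≡⟨ ⌜numeral⌝ (pred (value σ u)) ⟨
    ⌜ numeral (pred (value σ u)) ⌝ ∎
    where open ≡-Reasoning

  mutual
    psub-psubᵗ : ∀ {n} σ θ (t : Term n) → applyᵗ σ (psubᵗ θ t) ≡ applyᵗ (σ ∘ₚ θ) t
    psub-psubᵗ σ θ (num k) = refl
    psub-psubᵗ σ θ ⌈ t ⌉   = psub-psubᵒ σ θ t

    psub-psubᵒ : ∀ {n} σ θ (t : NonNumeral n) → applyᵗ σ (psubᵒ θ t) ≡ psubᵒ (asParSub (σ ∘ₚ θ)) t
    psub-psubᵒ σ θ (par m)   = psub-⌜⌝ σ (θ m)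
    psub-psubᵒ σ θ (fvar y)  = refl
    psub-psubᵒ σ θ (bvar i)  = refl
    psub-psubᵒ σ θ (sᵒ t)    = trans (psub-s _ (psubᵒ θ t)) (cong s (psub-psubᵒ σ θ t))
    psub-psubᵒ σ θ (pᵒ t)    = trans (psub-p _ (psubᵒ θ t)) (cong p (psub-psubᵒ σ θ t))
    psub-psubᵒ σ θ (fn f ts) = cong (λ us → ⌈ fn f us ⌉) (psub-psubᵛ σ θ ts)

    psub-psubᵛ : ∀ {n k} σ θ (ts : Vec (Term n) k) →
                 psubᵛ (asParSub σ) (psubᵛ θ ts) ≡ psubᵛ (asParSub (σ ∘ₚ θ)) ts
    psub-psubᵛ σ θ []       = refl
    psub-psubᵛ σ θ (t ∷ ts) = cong₂ _∷_ (psub-psubᵗ σ θ t) (psub-psubᵛ σ θ ts)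

  psub-psub : ∀ {n} σ θ (A : Form n) → apply σ (psub θ A) ≡ apply (σ ∘ₚ θ) A
  psub-psub σ θ (atom (cmp c t u)) =
    cong₂ (λ t u → atom (cmp c t u)) (psub-psubᵗ σ θ t) (psub-psubᵗ σ θ u)
  psub-psub σ θ (atom (rel P ts))  = cong (λ us → atom (rel P us)) (psub-psubᵛ σ θ ts)
  psub-psub σ θ (~ A)              = cong ~_ (psub-psub σ θ A)
  psub-psub σ θ (A ∧ᶠ B)           = cong₂ _∧ᶠ_ (psub-psub σ θ A) (psub-psub σ θ B)
  psub-psub σ θ (A ∨ᶠ B)           = cong₂ _∨ᶠ_ (psub-psub σ θ A) (psub-psub σ θ B)
  psub-psub σ θ (A ⇒ᶠ B)           = cong₂ _⇒ᶠ_ (psub-psub σ θ A) (psub-psub σ θ B)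
  psub-psub σ θ (quant q A)        = cong (quant q) (psub-psub σ θ A)

  mutual
    psub-subᵗ : ∀ {m n} θ {τ τ′ : Fin m → Term n} → (∀ i → psubᵗ θ (τ i) ≡ τ′ i) →
                ∀ t → psubᵗ θ (subᵗ τ t) ≡ subᵗ τ′ (psubᵗ θ t)
    psub-subᵗ θ τ≡ (num k) = refl
    psub-subᵗ θ τ≡ ⌈ t ⌉   = psub-subᵒ θ τ≡ t

    psub-subᵒ : ∀ {m n} θ {τ τ′ : Fin m → Term n} → (∀ i → psubᵗ θ (τ i) ≡ τ′ i) →
                ∀ t → psubᵗ θ (subᵒ τ t) ≡ subᵗ τ′ (psubᵒ θ t)
    psub-subᵒ θ {τ′ = τ′} τ≡ (par m) = sym (sub-⌜⌝ τ′ (θ m))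
    psub-subᵒ θ τ≡ (fvar y)          = refl
    psub-subᵒ θ τ≡ (bvar i)          = τ≡ i
    psub-subᵒ θ {τ} {τ′} τ≡ (sᵒ t)   =
      trans (psub-s θ (subᵒ τ t)) (trans (cong s (psub-subᵒ θ τ≡ t)) (sym (sub-s τ′ (psubᵒ θ t))))
    psub-subᵒ θ {τ} {τ′} τ≡ (pᵒ t)   =
      trans (psub-p θ (subᵒ τ t)) (trans (cong p (psub-subᵒ θ τ≡ t)) (sym (sub-p τ′ (psubᵒ θ t))))
    psub-subᵒ θ τ≡ (fn f ts)         = cong (λ us → ⌈ fn f us ⌉) (psub-subᵛ θ τ≡ ts)

    psub-subᵛ : ∀ {m n k} θ {τ τ′ : Fin m → Term n} → (∀ i → psubᵗ θ (τ i) ≡ τ′ i) →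
                ∀ (ts : Vec (Term m) k) → psubᵛ θ (subᵛ τ ts) ≡ subᵛ τ′ (psubᵛ θ ts)
    psub-subᵛ θ τ≡ []       = refl
    psub-subᵛ θ τ≡ (t ∷ ts) = cong₂ _∷_ (psub-subᵗ θ τ≡ t) (psub-subᵛ θ τ≡ ts)

  psub-lift : ∀ {m n} θ {τ τ′ : Fin m → Term n} → (∀ i → psubᵗ θ (τ i) ≡ τ′ i) →
              ∀ i → psubᵗ θ (lift τ i) ≡ lift τ′ i
  psub-lift θ τ≡ zero        = refl
  psub-lift θ {τ} τ≡ (suc i) = trans (psub-subᵗ θ (λ _ → refl) (τ i)) (cong (subᵗ _) (τ≡ i))

  psub-sub : ∀ {m n} θ {τ τ′ : Fin m → Term n} → (∀ i → psubᵗ θ (τ i) ≡ τ′ i) →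
             ∀ A → psub θ (sub τ A) ≡ sub τ′ (psub θ A)
  psub-sub θ τ≡ (atom (cmp c t u)) =
    cong₂ (λ t u → atom (cmp c t u)) (psub-subᵗ θ τ≡ t) (psub-subᵗ θ τ≡ u)
  psub-sub θ τ≡ (atom (rel P ts))  = cong (λ us → atom (rel P us)) (psub-subᵛ θ τ≡ ts)
  psub-sub θ τ≡ (~ A)              = cong ~_ (psub-sub θ τ≡ A)
  psub-sub θ τ≡ (A ∧ᶠ B)           = cong₂ _∧ᶠ_ (psub-sub θ τ≡ A) (psub-sub θ τ≡ B)
  psub-sub θ τ≡ (A ∨ᶠ B)           = cong₂ _∨ᶠ_ (psub-sub θ τ≡ A) (psub-sub θ τ≡ B)
  psub-sub θ τ≡ (A ⇒ᶠ B)           = cong₂ _⇒ᶠ_ (psub-sub θ τ≡ A) (psub-sub θ τ≡ B)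
  psub-sub θ τ≡ (quant q A)        = cong (quant q) (psub-sub θ (psub-lift θ τ≡) A)

  psub-⟦⟧ : ∀ {β} θ (F′ : Form β) (η : Vec (Term 0) β) →
            psub θ (F′ ⟦ η ⟧) ≡ psub θ F′ ⟦ Vec.map (psubᵗ θ) η ⟧
  psub-⟦⟧ θ F′ η = psub-sub θ (λ i → sym (Vecₚ.lookup-map i (psubᵗ θ) η)) F′

  occurs-s : ∀ {n v} (t : Term n) → Occursᵗ v (s t) → Occursᵗ v t
  occurs-s ⌈ t ⌉ o = o

  occurs-p : ∀ {n v} (t : Term n) → Occursᵗ v (p t) → Occursᵗ v t
  occurs-p ⌈ t ⌉ o = o

  occurs-⌜⌝ : ∀ {n y} (u : T₀) → ¬ Occursᵗ {n} (inj₂ y) ⌜ u ⌝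
  occurs-⌜⌝ (s₀ u) o = occurs-⌜⌝ u (occurs-s ⌜ u ⌝ o)
  occurs-⌜⌝ (p₀ u) o = occurs-⌜⌝ u (occurs-p ⌜ u ⌝ o)

  mutual
    occurs-psubᵗ : ∀ {n y} θ (t : Term n) → Occursᵗ (inj₂ y) (psubᵗ θ t) → Occursᵗ (inj₂ y) t
    occurs-psubᵗ θ ⌈ t ⌉ o = occurs-psubᵒ θ t o

    occurs-psubᵒ : ∀ {n y} θ (t : NonNumeral n) → Occursᵗ (inj₂ y) (psubᵒ θ t) → Occursᵒ (inj₂ y) t
    occurs-psubᵒ θ (par m) o   = contradiction o (occurs-⌜⌝ (θ m))
    occurs-psubᵒ θ (fvar _) o  = o
    occurs-psubᵒ θ (sᵒ t) o    = occurs-psubᵒ θ t (occurs-s (psubᵒ θ t) o)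
    occurs-psubᵒ θ (pᵒ t) o    = occurs-psubᵒ θ t (occurs-p (psubᵒ θ t) o)
    occurs-psubᵒ θ (fn _ ts) o = occurs-psubᵛ θ ts o

    occurs-psubᵛ : ∀ {n k y} θ (ts : Vec (Term n) k) → Occursᵛ (inj₂ y) (psubᵛ θ ts) → Occursᵛ (inj₂ y) ts
    occurs-psubᵛ θ (t ∷ ts) = Sum.map (occurs-psubᵗ θ t) (occurs-psubᵛ θ ts)

  occurs-psub : ∀ {n y} θ (A : Form n) → Occurs (inj₂ y) (psub θ A) → Occurs (inj₂ y) A
  occurs-psub θ (atom (cmp _ t u)) = Sum.map (occurs-psubᵗ θ t) (occurs-psubᵗ θ u)
  occurs-psub θ (atom (rel _ ts))  = occurs-psubᵛ θ ts
  occurs-psub θ (~ A)              = occurs-psub θ A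
  occurs-psub θ (A ∧ᶠ B)           = Sum.map (occurs-psub θ A) (occurs-psub θ B)
  occurs-psub θ (A ∨ᶠ B)           = Sum.map (occurs-psub θ A) (occurs-psub θ B)
  occurs-psub θ (A ⇒ᶠ B)           = Sum.map (occurs-psub θ A) (occurs-psub θ B)
  occurs-psub θ (quant _ A)        = occurs-psub θ A

  ∉ˢ-apply : ∀ σ {y} (S : Sequent) → y ∉ˢ S → y ∉ˢ applyˢ σ S
  ∉ˢ-apply σ {y} S y∉S (inj₁ i , o) =
    y∉S (inj₁ i , occurs-psub (asParSub σ) (lookup (ante S) i)
      (subst (Occurs (inj₂ y)) (Vecₚ.lookup-map i (apply σ) (ante S)) o))
  ∉ˢ-apply σ {y} S y∉S (inj₂ i , o) =
    y∉S (inj₂ i , occurs-psub (asParSub σ) (lookup (succ S) i)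
      (subst (Occurs (inj₂ y)) (Vecₚ.lookup-map i (apply σ) (succ S)) o))

  unary-apply : ∀ σ {Γ A P} → Unary Γ A P → Unary (applyˢ σ Γ) (applyˢ σ A) (applyˢ σ P)
  unary-apply σ (weakenˡ A)      = weakenˡ _
  unary-apply σ (weakenʳ A)      = weakenʳ _
  unary-apply σ (contractˡ A)    = contractˡ _
  unary-apply σ (contractʳ A)    = contractʳ _
  unary-apply σ (¬ˡ A)           = ¬ˡ _
  unary-apply σ (¬ʳ A)           = ¬ʳ _
  unary-apply σ (∧ˡ₁ A B)        = ∧ˡ₁ _ _
  unary-apply σ (∧ˡ₂ A B)        = ∧ˡ₂ _ _
  unary-apply σ (∨ʳ₁ A B)        = ∨ʳ₁ _ _
  unary-apply σ (∨ʳ₂ A B)        = ∨ʳ₂ _ _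
  unary-apply σ (→ʳ A B)         = →ʳ _ _
  unary-apply σ (∀ˡ A t)
    rewrite psub-⟦⟧ (asParSub σ) A (t ∷ []) = ∀ˡ _ (applyᵗ σ t)
  unary-apply σ (∃ʳ A t)
    rewrite psub-⟦⟧ (asParSub σ) A (t ∷ []) = ∃ʳ _ (applyᵗ σ t)
  unary-apply σ {Γ} (∀ʳ A y y∉Γ y∉A)
    rewrite psub-⟦⟧ (asParSub σ) A (⌈ fvar y ⌉ ∷ []) =
    ∀ʳ _ y (∉ˢ-apply σ Γ y∉Γ) (∉ˢ-apply σ (∅⊢ quant ∀q A) y∉A)
  unary-apply σ {Γ} (∃ˡ A y y∉Γ y∉A)
    rewrite psub-⟦⟧ (asParSub σ) A (⌈ fvar y ⌉ ∷ []) =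
    ∃ˡ _ y (∉ˢ-apply σ Γ y∉Γ) (∉ˢ-apply σ (quant ∃q A ⊢∅) y∉A)

  binary-apply : ∀ σ {A₁ A₂ P} → Binary A₁ A₂ P → Binary (applyˢ σ A₁) (applyˢ σ A₂) (applyˢ σ P)
  binary-apply σ (∧ʳ A B) = ∧ʳ _ _
  binary-apply σ (∨ˡ A B) = ∨ˡ _ _
  binary-apply σ (→ˡ A B) = →ˡ _ _
  binary-apply σ (cut A)  = cut _

  -- Application of σ to a derivation, with the call inferences replaced.

  graft : ∀ {Ax Ax′ Call Call′} σ → (∀ {T} → Ax T → Ax′ (applyˢ σ T)) →
          ∀ {S} (d : Deriv Ax Call S) →
          (∀ {T} {c : Call T} → CallsIn d c → Deriv Ax′ Call′ (applyˢ σ T)) →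
          Deriv Ax′ Call′ (applyˢ σ S)
  graft σ ax (axiom a) κ = axiom (ax a)
  graft σ ax (call c) κ  = κ here
  graft σ ax (unary {Γ} {A} {P} r e e′ d) κ =
    unary (unary-apply σ r) (mapˢ-≋-⊕ (apply σ) P Γ e) (mapˢ-≋-⊕ (apply σ) A Γ e′)
          (graft σ ax d (κ ∘ up))
  graft σ ax (binary {Γ₁} {Γ₂} {A₁} {A₂} {P} r e e₁ e₂ d₁ d₂) κ =
    binary (binary-apply σ r) (mapˢ-≋-⊕-⊕ (apply σ) P Γ₁ Γ₂ e)
           (mapˢ-≋-⊕ (apply σ) A₁ Γ₁ e₁) (mapˢ-≋-⊕ (apply σ) A₂ Γ₂ e₂)
           (graft σ ax d₁ (κ ∘ left)) (graft σ ax d₂ (κ ∘ right))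

  convert : ∀ {Ax Call S T} → (Ax S → Ax T) → (Call S → Call T) → T ≋ S → Deriv Ax Call S → Deriv Ax Call T
  convert ax cl e (axiom a)                = axiom (ax a)
  convert ax cl e (call c)                 = call (cl c)
  convert ax cl e (unary r e₀ e′ d)        = unary r (≋-trans e e₀) e′ d
  convert ax cl e (binary r e₀ e₁ e₂ d₁ d₂) = binary r (≋-trans e e₀) e₁ e₂ d₁ d₂

  ----------------------------------------------------------------------

  record ProofSymbols : Set where
    field
      #R       : ℕ
    R : Set
    R = Fin #R
    field
      𝒩₀       : List Par
      arity    : R → ℕ
      t        : ∀ ρ → Vec Par (arity ρ)
      t-unique : ∀ ρ → Unique (t ρ)
      t⊆𝒩₀     : ∀ ρ {m} → m VecMem.∈ t ρ → m ∈ 𝒩₀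
      Seq      : R → Sequent
      Seq-par  : ∀ ρ m → Occursˢ (inj₁ m) (Seq ρ) ⇔ m VecMem.∈ t ρ

  -- A call inference with conclusion S and premise the proof term
  -- callee(k₁, …, k_r){k₁ ← u₁, …, k_r ← u_r}, where args = (u₁, …, u_r).

  record Call (𝒫 : ProofSymbols) (S : Sequent) : Set where
    open ProofSymbols 𝒫
    field
      callee : R
      args   : Vec T₀ (arity callee)
    θ : ParSub
    θ = ⟨ t callee ← args ⟩
    field
      concl  : S ≋ mapˢ (psub θ) (Seq callee)

    calleeOcc : Occ S → Occ (Seq callee)
    calleeOcc = move concl

  record SemiProofSchema : Set₁ where
    field
      symbols : ProofSymbols
    open ProofSymbols symbols public
    field
      ρ₀        : R
      #cases    : R → ℕ
      C         : ∀ ρ → Fin (#cases ρ) → Cond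
      partition : ∀ ρ → IsPartition (C ρ)
      ξ         : ∀ ρ j → Deriv (Axiom (C ρ j)) (Call symbols) (Seq ρ)
      ξ-par     : ∀ ρ j m → OccursInDeriv (inj₁ m) (ξ ρ j) ⇔ m VecMem.∈ t ρ

  module _ (P : SemiProofSchema) where
    open SemiProofSchema P

    -- Labels of the point transition system; nothing is the end label δₑ.

    Label : Set
    Label = Maybe R

    data Target (ρ : R) (j : Fin (#cases ρ)) : Label → List T₀ → Set₁ where
      call : ∀ {T} {c : Call symbols T} → CallsIn (ξ ρ j) c →
             Target ρ j (just (Call.callee c)) (Vec.toList (Call.args c))
      end  : (∀ {T} {c : Call symbols T} → ¬ CallsIn (ξ ρ j) c) →
             Target ρ j nothing (Vec.toList (Vec.map par₀ (t ρ)))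

    data _↝_ : Label → Label → Set₁ where
      step : ∀ {ρ j δ q} → Target ρ j δ q → just ρ ↝ δ

    _→*_ : Label → Label → Set₁
    _→*_ = TransClosure _↝_

    values : Assignment → List T₀ → List ℕ
    values σ = List.map (value σ)

    record Canonic : Set₁ where
      field
        _<ₗ_       : Rel (List ℕ) 0ℓ
        <ₗ-strict  : IsStrictPartialOrder _≡_ _<ₗ_
        <ₗ-wf      : WellFounded _<ₗ_
        decreasing : ∀ ρ j {δ q′} → Target ρ j δ q′ →
          (just ρ →* δ × ¬ (δ →* just ρ))
          ⊎ (just ρ →* δ × δ →* just ρ ×
             (∀ σ → σ ⊨ C ρ j → values σ q′ <ₗ values σ (Vec.toList (Vec.map par₀ (t ρ)))))

    --------------------------------------------------------------------

    Config : Set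
    Config = R × Assignment

    -- Maps each kᵢ to σ(uᵢ); agrees with σ on the parameters other than the kᵢ.
    callAssignment : Assignment → ∀ {T} → Call symbols T → Assignment
    callAssignment σ c = σ ∘ₚ Call.θ c

    data _≺_ : Config → Config → Set₁ where
      call : ∀ {ρ j σ T} {c : Call symbols T} → σ ⊨ C ρ j → CallsIn (ξ ρ j) c →
             (Call.callee c , callAssignment σ c) ≺ (ρ , σ)

    -- The σ-images of the axioms available in the case selected by σ.
    data AxiomImage (S : Sequent) : Set₁ where
      image : ∀ σ ρ j {S₀} → σ ⊨ C ρ j → Axiom (C ρ j) S₀ → S ≋ applyˢ σ S₀ → AxiomImage S

    LKProof : Sequent → Set₁
    LKProof = Deriv AxiomImage (λ _ → ⊥)

    toCaller : ∀ σ {T} (c : Call symbols T) →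
               applyˢ σ T ≋ applyˢ (callAssignment σ c) (Seq (Call.callee c))
    toCaller σ c = ≋-resp (fuse (ante S₀)) (fuse (succ S₀)) (mapˢ-≋ (apply σ) (Call.concl c))
      where
      S₀ = Seq (Call.callee c)

      fuse : ∀ {n} (As : Vec (Form 0) n) →
             Vec.map (apply σ) (Vec.map (psub (Call.θ c)) As) ≡ Vec.map (apply (callAssignment σ c)) As
      fuse As = trans (sym (Vecₚ.map-∘ (apply σ) (psub (Call.θ c)) As))
                      (Vecₚ.map-cong (psub-psub σ (Call.θ c)) As)

    -- σ(ρ(t))↓, by recursion on accessibility in the relation from a
    -- configuration to the ones it calls.
    evaluate′ : ∀ ρ σ → Acc _≺_ (ρ , σ) → LKProof (applyˢ σ (Seq ρ))
    evaluate′ ρ σ (acc rs) with partition ρ σ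
    ... | j , σ⊨C , _ =
      graft σ (λ a → image σ ρ j σ⊨C a ≋-refl) (ξ ρ j) λ {_} {c} c∈ξ →
        convert (λ { (image σ′ ρ′ j′ σ′⊨C a e) → image σ′ ρ′ j′ σ′⊨C a (≋-trans (toCaller σ c) e) }) id
                (toCaller σ c)
                (evaluate′ (Call.callee c) (callAssignment σ c) (rs (call σ⊨C c∈ξ)))

    --------------------------------------------------------------------

    module _ (canonic : Canonic) where
      open Canonic canonic

      _⊏_ : R → R → Set₁
      ρ′ ⊏ ρ = just ρ →* just ρ′ × ¬ (just ρ′ →* just ρ)

      ⊏-strict : IsStrictPartialOrder _≡_ _⊏_
      ⊏-strict = record
        { isEquivalence = isEquivalence
        ; irrefl        = λ { refl (ρ→ρ , ρ↛ρ) → ρ↛ρ ρ→ρ }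
        ; trans         = λ { (j→i , i↛j) (k→j , j↛k) → k→j ++ j→i , λ i→k → i↛j (i→k ++ k→j) }
        ; <-resp-≈      = (λ { refl x → x }) , (λ { refl x → x })
        }

      tuple : Config → List ℕ
      tuple (ρ , σ) = values σ (Vec.toList (Vec.map par₀ (t ρ)))

      tuple-call : ∀ σ {T} (c : Call symbols T) →
                   tuple (Call.callee c , callAssignment σ c) ≡ values σ (Vec.toList (Call.args c))
      tuple-call σ c = go (t (Call.callee c)) (Call.args c) (λ i → ⟨←⟩-lookup (t-unique _) i)
        where
        go : ∀ {r} (ks : Vec Par r) (us : Vec T₀ r) → (∀ i → Call.θ c (lookup ks i) ≡ lookup us i) →
             values (callAssignment σ c) (Vec.toList (Vec.map par₀ ks)) ≡ values σ (Vec.toList us)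
        go []       []       _  = refl
        go (k ∷ ks) (u ∷ us) θ≡ = cong₂ _∷_ (cong (value σ) (θ≡ zero)) (go ks us (θ≡ ∘ suc))

      -- Either ρ or a symbol that is mutually reachable with ρ.

      _~ᴿ_ : R → R → Set₁
      ρ′ ~ᴿ ρ = ρ′ ≡ ρ ⊎ (just ρ →* just ρ′ × just ρ′ →* just ρ)

      ⊏-~ᴿ : ∀ {ρ₁ ρ₂ ρ₃} → ρ₁ ⊏ ρ₂ → ρ₂ ~ᴿ ρ₃ → ρ₁ ⊏ ρ₃
      ⊏-~ᴿ ρ₁⊏ρ₂ (inj₁ refl) = ρ₁⊏ρ₂
      ⊏-~ᴿ (2→1 , 1↛2) (inj₂ (3→2 , 2→3)) = 3→2 ++ 2→1 , λ 1→3 → 1↛2 (1→3 ++ 3→2)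

      ~ᴿ-trans : ∀ {ρ₁ ρ₂ ρ₃} → just ρ₂ →* just ρ₁ → just ρ₁ →* just ρ₂ → ρ₂ ~ᴿ ρ₃ → ρ₁ ~ᴿ ρ₃
      ~ᴿ-trans 2→1 1→2 (inj₁ refl)        = inj₂ (2→1 , 1→2)
      ~ᴿ-trans 2→1 1→2 (inj₂ (3→2 , 2→3)) = inj₂ (3→2 ++ 2→1 , 1→2 ++ 2→3)

      ≺-acc-class : ∀ {ρ} → (∀ {ρ″} → ρ″ ⊏ ρ → ∀ σ → Acc _≺_ (ρ″ , σ)) → ∀ {q} → Acc _<ₗ_ q →
                    ∀ {ρ′ σ} → ρ′ ~ᴿ ρ → tuple (ρ′ , σ) ≡ q → Acc _≺_ (ρ′ , σ)
      ≺-acc-class below (acc rs) {ρ′} {σ} ρ′~ρ refl = acc callee-acc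
        where
        callee-acc : ∀ {y} → y ≺ (ρ′ , σ) → Acc _≺_ y
        callee-acc (call {j = j} {c = c} σ⊨C c∈ξ) with decreasing ρ′ j (call c∈ξ)
        ... | inj₁ ρ″⊏ρ′                 = below (⊏-~ᴿ ρ″⊏ρ′ ρ′~ρ) _
        ... | inj₂ (ρ′→ρ″ , ρ″→ρ′ , dec) =
          ≺-acc-class below (rs (dec σ σ⊨C)) (~ᴿ-trans ρ′→ρ″ ρ″→ρ′ ρ′~ρ) (tuple-call σ c)

      ≺-acc : ∀ {ρ} → Acc _⊏_ ρ → ∀ σ → Acc _≺_ (ρ , σ)
      ≺-acc (acc rs) σ = ≺-acc-class (λ ρ″⊏ρ → ≺-acc (rs ρ″⊏ρ)) (<ₗ-wf _) (inj₁ refl) refl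

      ≺-wf : WellFounded _≺_
      ≺-wf (ρ , σ) = ≺-acc (spo-wellFounded ⊏-strict ρ) σ

    --------------------------------------------------------------------
    -- Θ* σ ρ μ η means η ∈ σ(Θ*(ρ, μ))↓: the recursive unions of the Herbrand
    -- system amount to the least family of sets closed under the clauses below.
    -- In done, the assumption Hi q F′ τ θ makes τ end in an axiom or a call.

    data Θ* (σ : Assignment) (ρ : R) (μ : Occ (Seq ρ)) : ∀ {β} → Vec (Term 0) β → Set₁ where

      done : ∀ {j q β} {F′ : Form β} {T} {d : Deriv (Axiom (C ρ j)) (Call symbols) T} {ν}
             {θ : Vec (Term 0) β} →
             σ ⊨ C ρ j → 1 ≤ β → QF F′ → Seq ρ at μ ≡ quants q F′ →
             (τ : Path (ξ ρ j) μ d ν) → Hi q F′ τ θ → QF (T at ν) →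
             Θ* σ ρ μ (Vec.map (applyᵗ σ) θ)

      untouched : ∀ {j q β} {F′ : Form β} {T} {c : Call symbols T} {ν} {η : Vec (Term 0) β} →
                  σ ⊨ C ρ j → 1 ≤ β → QF F′ → Seq ρ at μ ≡ quants q F′ →
                  (τ : Path (ξ ρ j) μ (call c) ν) → T at ν ≡ quants q F′ →
                  Θ* (callAssignment σ c) (Call.callee c) (Call.calleeOcc c ν) η →
                  Θ* σ ρ μ η

      partial : ∀ {j q k i} {F′ : Form (k + i)} {T} {c : Call symbols T} {ν}
                {θ : Vec (Term 0) i} {η : Vec (Term 0) k} →
                σ ⊨ C ρ j → 1 ≤ k → 1 ≤ i → QF F′ → Seq ρ at μ ≡ quants q F′ →
                (τ : Path (ξ ρ j) μ (call c) ν) → Hi q F′ τ θ →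
                T at ν ≡ quants q (partially k F′ θ) →
                Θ* (callAssignment σ c) (Call.callee c) (Call.calleeOcc c ν) η →
                Θ* σ ρ μ (η Vec.++ Vec.map (applyᵗ σ) θ)

  record ProofSchema : Set₁ where
    field
      semi    : SemiProofSchema
      canonic : Canonic semi
    open SemiProofSchema semi public

    evaluate : ∀ ρ σ → LKProof semi (applyˢ σ (Seq ρ))
    evaluate ρ σ = evaluate′ semi ρ σ (≺-wf semi canonic (ρ , σ))

-- A path of immediate ancestors from Q x₁ … Q x_β F′ first consumes the
-- quantifiers one after the other and then descends into the resulting instance
-- of F′, so the instances performed along it determine which clause of hi applies.
-- Paths in an evaluated proof are concatenations of σ-images of paths in the
-- s-proofs, cut at the calls.  Hence both directions reduce to matching lists of
-- instances: a member of the evaluated Herbrand system prescribes such a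
-- concatenation ending in a quantifier-free formula, and conversely a trace
-- decomposes into one, by recursion on the calls.

module Submission where

open import Defs
open import Data.Fin.Base using (Fin; zero; suc; splitAt; cast)
import Data.Fin.Permutation as Perm
open import Data.Fin.Properties using (cast-is-id)
open import Data.List.Base as List using (List; []; _∷_; _∷ʳ_)
open import Data.List.Membership.Propositional using (_∈_)
import Data.List.Properties as Listₚ
open import Data.List.Relation.Unary.Any using (here; there)
open import Data.Maybe.Base as Maybe using (Maybe; just; nothing)
open import Data.Nat.Base using (ℕ; zero; suc; _+_; _≤_; z≤n; s≤s)
open import Data.Nat.Properties
  using (≤-refl; ≤-reflexive; ≤-trans; +-assoc; +-comm; +-suc; +-identityʳ; +-monoˡ-≤;
         m≤n⇒m≤n+o; m≤n⇒m≤o+n; m+1+n≰m; module ≤-Reasoning)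
open import Data.Product.Base using (Σ-syntax; ∃-syntax; _×_; _,_)
open import Data.Sum.Base using (inj₁; inj₂; [_,_]′)
open import Data.Vec.Base as Vec using (Vec; []; _∷_; lookup)
import Data.Vec.Properties as Vecₚ
open import Function.Base using (_∘_; id)
open import Induction.WellFounded using (Acc; acc)
open import Relation.Binary.PropositionalEquality
  using (_≡_; refl; sym; trans; cong; cong₂; subst; module ≡-Reasoning)
open import Relation.Nullary using (¬_; contradiction)

-- The formula at the end of a path does not determine the substitution, since a matrix need not
-- contain all of its variables; the list of instances does. At a call both the assignment and the
-- matrix change: the matrix seen by the caller is only a parameter instance of the one in the
-- callee. Therefore the induction for soundness carries no matrix, but only a list of instances and
-- the fact that the path stops at some quantifier-free formula; the matrix is recovered at the end
-- by analysing the path in the evaluated proof itself. A further mismatch: the Herbrand system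
-- stops at a call whose formula is quantifier-free, while the trace runs on through the called
-- proof. This does no harm because nothing is instantiated beyond a quantifier-free formula.

module _ (L : Language) where

  open Schemata L

  private variable
    k m n β : ℕ
    q       : Quantifier

  -- Algebra of simultaneous substitutions.

  weaken : Fin n → Term (suc n)
  weaken j = ⌈ bvar (suc j) ⌉

  mutual
    sub-idᵗ : {τ : Fin n → Term n} → (∀ i → τ i ≡ ⌈ bvar i ⌉) → ∀ t → subᵗ τ t ≡ t
    sub-idᵗ τ≡ (num k) = refl
    sub-idᵗ τ≡ ⌈ t ⌉   = sub-idᵒ τ≡ t

    sub-idᵒ : {τ : Fin n → Term n} → (∀ i → τ i ≡ ⌈ bvar i ⌉) → ∀ t → subᵒ τ t ≡ ⌈ t ⌉
    sub-idᵒ τ≡ (par m)   = refl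
    sub-idᵒ τ≡ (fvar y)  = refl
    sub-idᵒ τ≡ (bvar i)  = τ≡ i
    sub-idᵒ τ≡ (sᵒ t)    = cong s (sub-idᵒ τ≡ t)
    sub-idᵒ τ≡ (pᵒ t)    = cong p (sub-idᵒ τ≡ t)
    sub-idᵒ τ≡ (fn f ts) = cong (λ us → ⌈ fn f us ⌉) (sub-idᵛ τ≡ ts)

    sub-idᵛ : {τ : Fin n → Term n} → (∀ i → τ i ≡ ⌈ bvar i ⌉) → (ts : Vec (Term n) k) → subᵛ τ ts ≡ ts
    sub-idᵛ τ≡ []       = refl
    sub-idᵛ τ≡ (t ∷ ts) = cong₂ _∷_ (sub-idᵗ τ≡ t) (sub-idᵛ τ≡ ts)

  sub-id : {τ : Fin n → Term n} → (∀ i → τ i ≡ ⌈ bvar i ⌉) → ∀ A → sub τ A ≡ A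
  sub-id τ≡ (atom (cmp c t u)) = cong₂ (λ t u → atom (cmp c t u)) (sub-idᵗ τ≡ t) (sub-idᵗ τ≡ u)
  sub-id τ≡ (atom (rel P ts))  = cong (λ us → atom (rel P us)) (sub-idᵛ τ≡ ts)
  sub-id τ≡ (~ A)              = cong ~_ (sub-id τ≡ A)
  sub-id τ≡ (A ∧ᶠ B)           = cong₂ _∧ᶠ_ (sub-id τ≡ A) (sub-id τ≡ B)
  sub-id τ≡ (A ∨ᶠ B)           = cong₂ _∨ᶠ_ (sub-id τ≡ A) (sub-id τ≡ B)
  sub-id τ≡ (A ⇒ᶠ B)           = cong₂ _⇒ᶠ_ (sub-id τ≡ A) (sub-id τ≡ B)
  sub-id τ≡ (quant q A)        =
    cong (quant q) (sub-id (λ { zero → refl ; (suc i) → cong (subᵗ weaken) (τ≡ i) }) A)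

  mutual
    sub-subᵗ : {τ : Fin k → Term m} {τ′ : Fin m → Term n} {τ″ : Fin k → Term n} →
               (∀ i → subᵗ τ′ (τ i) ≡ τ″ i) → ∀ t → subᵗ τ′ (subᵗ τ t) ≡ subᵗ τ″ t
    sub-subᵗ τ≡ (num k) = refl
    sub-subᵗ τ≡ ⌈ t ⌉   = sub-subᵒ τ≡ t

    sub-subᵒ : {τ : Fin k → Term m} {τ′ : Fin m → Term n} {τ″ : Fin k → Term n} →
               (∀ i → subᵗ τ′ (τ i) ≡ τ″ i) → ∀ t → subᵗ τ′ (subᵒ τ t) ≡ subᵒ τ″ t
    sub-subᵒ τ≡ (par m)             = refl
    sub-subᵒ τ≡ (fvar y)            = refl
    sub-subᵒ τ≡ (bvar i)            = τ≡ i
    sub-subᵒ {τ = τ} {τ′} τ≡ (sᵒ t) = trans (sub-s τ′ (subᵒ τ t)) (cong s (sub-subᵒ τ≡ t))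
    sub-subᵒ {τ = τ} {τ′} τ≡ (pᵒ t) = trans (sub-p τ′ (subᵒ τ t)) (cong p (sub-subᵒ τ≡ t))
    sub-subᵒ τ≡ (fn f ts)           = cong (λ us → ⌈ fn f us ⌉) (sub-subᵛ τ≡ ts)

    sub-subᵛ : {τ : Fin k → Term m} {τ′ : Fin m → Term n} {τ″ : Fin k → Term n} →
               (∀ i → subᵗ τ′ (τ i) ≡ τ″ i) → ∀ {l} (ts : Vec (Term k) l) →
               subᵛ τ′ (subᵛ τ ts) ≡ subᵛ τ″ ts
    sub-subᵛ τ≡ []       = refl
    sub-subᵛ τ≡ (t ∷ ts) = cong₂ _∷_ (sub-subᵗ τ≡ t) (sub-subᵛ τ≡ ts)

  lift-weaken : (τ : Fin m → Term n) → ∀ t → subᵗ (lift τ) (subᵗ weaken t) ≡ subᵗ weaken (subᵗ τ t)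
  lift-weaken τ t = trans (sub-subᵗ (λ _ → refl) t) (sym (sub-subᵗ (λ _ → refl) t))

  sub-sub : {τ : Fin k → Term m} {τ′ : Fin m → Term n} {τ″ : Fin k → Term n} →
            (∀ i → subᵗ τ′ (τ i) ≡ τ″ i) → ∀ A → sub τ′ (sub τ A) ≡ sub τ″ A
  sub-sub τ≡ (atom (cmp c t u)) = cong₂ (λ t u → atom (cmp c t u)) (sub-subᵗ τ≡ t) (sub-subᵗ τ≡ u)
  sub-sub τ≡ (atom (rel P ts))  = cong (λ us → atom (rel P us)) (sub-subᵛ τ≡ ts)
  sub-sub τ≡ (~ A)              = cong ~_ (sub-sub τ≡ A)
  sub-sub τ≡ (A ∧ᶠ B)           = cong₂ _∧ᶠ_ (sub-sub τ≡ A) (sub-sub τ≡ B)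
  sub-sub τ≡ (A ∨ᶠ B)           = cong₂ _∨ᶠ_ (sub-sub τ≡ A) (sub-sub τ≡ B)
  sub-sub τ≡ (A ⇒ᶠ B)           = cong₂ _⇒ᶠ_ (sub-sub τ≡ A) (sub-sub τ≡ B)
  sub-sub {τ = τ} {τ′} τ≡ (quant q A) = cong (quant q) (sub-sub
    (λ { zero → refl ; (suc i) → trans (lift-weaken τ′ (τ i)) (cong (subᵗ weaken) (τ≡ i)) }) A)

  -- Stands in for function extensionality: with the identity as inner substitution, the hypothesis
  -- of `sub-sub` is exactly pointwise agreement.
  sub-cong : {τ τ′ : Fin m → Term n} → (∀ i → τ i ≡ τ′ i) → ∀ A → sub τ A ≡ sub τ′ A
  sub-cong τ≡ A =
    trans (cong (sub _) (sym (sub-id (λ _ → refl) A))) (sub-sub τ≡ A)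

  -- Quantifier-free formulas and quantifier prefixes.

  QF-sub : (τ : Fin m → Term n) → ∀ A → QF A → QF (sub τ A)
  QF-sub τ (atom _)  qf      = qf
  QF-sub τ (~ A)     qf      = QF-sub τ A qf
  QF-sub τ (A ∧ᶠ B)  (a , b) = QF-sub τ A a , QF-sub τ B b
  QF-sub τ (A ∨ᶠ B)  (a , b) = QF-sub τ A a , QF-sub τ B b
  QF-sub τ (A ⇒ᶠ B)  (a , b) = QF-sub τ A a , QF-sub τ B b

  QF-psub : (θ : ParSub) (A : Form n) → QF A → QF (psub θ A)
  QF-psub θ (atom _)  qf      = qf
  QF-psub θ (~ A)     qf      = QF-psub θ A qf
  QF-psub θ (A ∧ᶠ B)  (a , b) = QF-psub θ A a , QF-psub θ B b
  QF-psub θ (A ∨ᶠ B)  (a , b) = QF-psub θ A a , QF-psub θ B b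
  QF-psub θ (A ⇒ᶠ B)  (a , b) = QF-psub θ A a , QF-psub θ B b

  QF-psub⁻¹ : (θ : ParSub) (A : Form n) → QF (psub θ A) → QF A
  QF-psub⁻¹ θ (atom _)  qf      = qf
  QF-psub⁻¹ θ (~ A)     qf      = QF-psub⁻¹ θ A qf
  QF-psub⁻¹ θ (A ∧ᶠ B)  (a , b) = QF-psub⁻¹ θ A a , QF-psub⁻¹ θ B b
  QF-psub⁻¹ θ (A ∨ᶠ B)  (a , b) = QF-psub⁻¹ θ A a , QF-psub⁻¹ θ B b
  QF-psub⁻¹ θ (A ⇒ᶠ B)  (a , b) = QF-psub⁻¹ θ A a , QF-psub⁻¹ θ B b

  psub-quants : (θ : ParSub) (A : Form β) → psub θ (quants q A) ≡ quants q (psub θ A)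
  psub-quants {zero}  θ A = refl
  psub-quants {suc β} θ A = psub-quants θ (quant _ A)

  -- Parameter substitution keeps every connective, so a prefix in the image comes from a prefix in
  -- `A`. At calls this recovers the matrix of the callee's formula.
  psub-quants⁻¹ : ∀ θ A (B : Form β) → psub θ A ≡ quants q B → ∃[ C ] A ≡ quants q C × psub θ C ≡ B
  psub-quants⁻¹ {zero}  θ A B θA≡ = A , refl , θA≡
  psub-quants⁻¹ {suc β} θ A B θA≡ with psub-quants⁻¹ θ A (quant _ B) θA≡
  ... | quant _ C , A≡ , refl = C , A≡ , refl

  ¬QF-quants : 1 ≤ β → (A : Form β) → ¬ QF (quants q A)
  ¬QF-quants {1}           _ A ()
  ¬QF-quants {suc (suc β)} _ A qf = ¬QF-quants (s≤s z≤n) (quant _ A) qf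

  -- `quants` adds the innermost quantifier first, so the outermost one, which a path meets first,
  -- sits at the end of the recursion. Stopping one variable short leaves x₁ free.
  quants₁ : Quantifier → Form (suc k) → Form 1
  quants₁ {zero}  q A = A
  quants₁ {suc k} q A = quants₁ q (quant q A)

  quants-suc : (A : Form (suc k)) → quants q A ≡ quant q (quants₁ q A)
  quants-suc {zero}  A = refl
  quants-suc {suc k} A = quants-suc (quant _ A)

  -- Replaces the highest index, that of x₁. The iterated `lift` is what a substitution for x₁
  -- becomes on its way through the inner binders, which makes the inductive case of the next lemma
  -- definitional.
  outermost : Term 0 → Fin (suc k) → Term k
  outermost {zero}  t _ = t
  outermost {suc k} t   = lift (outermost t)

  quants₁-⟦⟧ : (A : Form (suc k)) (t : Term 0) →
               quants₁ q A ⟦ t ∷ [] ⟧ ≡ quants q (sub (outermost t) A)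
  quants₁-⟦⟧ {zero}  A t = sub-cong (λ { zero → refl }) A
  quants₁-⟦⟧ {suc k} A t = quants₁-⟦⟧ (quant _ A) t

  -- `t` is closed, hence unaffected by `θ`; it goes to the end because x₁ has the highest index.
  ⟦⟧-∷ʳ : (A : Form (suc k)) (θ : Vec (Term 0) k) (t : Term 0) →
          sub (outermost t) A ⟦ θ ⟧ ≡ A ⟦ θ Vec.∷ʳ t ⟧
  ⟦⟧-∷ʳ A θ t = sub-sub (pointwise θ) A
    where
    pointwise : (θ : Vec (Term 0) k) → ∀ i → subᵗ (lookup θ) (outermost t i) ≡ lookup (θ Vec.∷ʳ t) i
    pointwise []      zero    = sub-idᵗ (λ ()) t
    pointwise (u ∷ θ) zero    = refl
    pointwise (u ∷ θ) (suc i) = trans (sub-subᵗ (λ _ → refl) (outermost t i)) (pointwise θ i)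

  -- Partial instances of a matrix.

  part : ∀ k {i} → Vec (Term 0) i → Fin (k + i) → Term k
  part k θ x = [ (λ j → ⌈ bvar j ⌉) , (λ j → subᵗ (λ ()) (lookup θ j)) ]′ (splitAt k x)

  part-suc : ∀ k {i} (θ : Vec (Term 0) i) x → part (suc k) θ (suc x) ≡ subᵗ weaken (part k θ x)
  part-suc k θ x with splitAt k x
  ... | inj₁ j = refl
  ... | inj₂ j = sym (sub-subᵗ (λ ()) (lookup θ j))

  -- Trades a transport of formulas for a renaming of variables. `cast` is irrelevant in its
  -- equation, so the next lemmas hold for any proof of it.
  partially-subst : ∀ {k i} (e : β ≡ k + i) (A : Form β) (θ : Vec (Term 0) i) →
                    partially k (subst Form e A) θ ≡ sub (part k θ ∘ cast e) A
  partially-subst {k = k} refl A θ = sub-cong (λ x → cong (part k θ) (sym (cast-is-id refl x))) A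

  partially-[] : ∀ {k} (A : Form (suc k)) (t : Term 0) .{e} →
                 sub (outermost t) A ≡ sub (part k (t ∷ []) ∘ cast e) A
  partially-[] A t = sub-cong (λ i → pointwise i) A
    where
    pointwise : ∀ {k} (x : Fin (suc k)) .{e} → outermost t x ≡ part k (t ∷ []) (cast e x)
    pointwise {zero}  zero    = sym (sub-idᵗ (λ ()) t)
    pointwise {suc k} zero    = refl
    pointwise {suc k} (suc x) =
      trans (cong (subᵗ weaken) (pointwise x)) (sym (part-suc k (t ∷ []) (cast _ x)))

  partially-∷ʳ : ∀ {k i} (A : Form (suc (k + i))) (θ : Vec (Term 0) i) (t : Term 0) .{e} →
                 partially k (sub (outermost t) A) θ ≡ sub (part k (θ Vec.∷ʳ t) ∘ cast e) A
  partially-∷ʳ {k} {i} A θ t = sub-sub (λ x → pointwise k θ x) A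
    where
    pointwise : ∀ k {i} (θ : Vec (Term 0) i) (x : Fin (suc (k + i))) .{e} →
                subᵗ (part k θ) (outermost t x) ≡ part k (θ Vec.∷ʳ t) (cast e x)
    pointwise zero    []      zero    = trans (sub-idᵗ (λ ()) t) (sym (sub-idᵗ (λ ()) t))
    pointwise zero    (u ∷ θ) zero    = refl
    pointwise zero    (u ∷ θ) (suc x) =
      trans (sub-subᵗ (λ _ → refl) (outermost t x)) (pointwise zero θ x)
    pointwise (suc k) θ       zero    = refl
    -- One kept variable is stripped: on the remaining ones both sides are weakenings of the claim
    -- for `k`.
    pointwise (suc k) θ       (suc x) = begin
      subᵗ (part (suc k) θ) (subᵗ weaken (outermost t x)) ≡⟨ sub-subᵗ (part-suc k θ) (outermost t x) ⟩
      subᵗ (subᵗ weaken ∘ part k θ) (outermost t x)       ≡⟨ sub-subᵗ (λ _ → refl) (outermost t x) ⟨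
      subᵗ weaken (subᵗ (part k θ) (outermost t x))       ≡⟨ cong (subᵗ weaken) (pointwise k θ x) ⟩
      subᵗ weaken (part k (θ Vec.∷ʳ t) (cast _ x))        ≡⟨ part-suc k (θ Vec.∷ʳ t) (cast _ x) ⟨
      part (suc k) (θ Vec.∷ʳ t) (suc (cast _ x))          ∎
      where open ≡-Reasoning

  -- Quantifier counts and lists of instances.

  #quants : Form n → ℕ
  #quants (atom _)    = 0
  #quants (~ A)       = #quants A
  #quants (A ∧ᶠ B)    = #quants A + #quants B
  #quants (A ∨ᶠ B)    = #quants A + #quants B
  #quants (A ⇒ᶠ B)    = #quants A + #quants B
  #quants (quant _ A) = suc (#quants A)

  #quants-sub : (τ : Fin m → Term n) → ∀ A → #quants (sub τ A) ≡ #quants A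
  #quants-sub τ (atom _)    = refl
  #quants-sub τ (~ A)       = #quants-sub τ A
  #quants-sub τ (A ∧ᶠ B)    = cong₂ _+_ (#quants-sub τ A) (#quants-sub τ B)
  #quants-sub τ (A ∨ᶠ B)    = cong₂ _+_ (#quants-sub τ A) (#quants-sub τ B)
  #quants-sub τ (A ⇒ᶠ B)    = cong₂ _+_ (#quants-sub τ A) (#quants-sub τ B)
  #quants-sub τ (quant _ A) = cong suc (#quants-sub (lift τ) A)

  -- Lists of instances have the outermost quantifier last, but a path meets it first; so the
  -- instance of an inference goes behind those from the rest of the path.
  snoc : List (Term 0) → Maybe (Term 0) → List (Term 0)
  snoc ts (just t) = ts ∷ʳ t
  snoc ts nothing  = ts

  -- Formulas at corresponding occurrences.

  at-move : {S T : Sequent} (e : S ≋ T) (μ : Occ S) → S at μ ≡ T at move e μ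
  at-move {S} ((p , p≡) , _) (inj₁ i) = trans (cong (lookup (ante S)) (sym (Perm.inverseʳ p))) (p≡ _)
  at-move {S} (_ , (p , p≡)) (inj₂ i) = trans (cong (lookup (succ S)) (sym (Perm.inverseʳ p))) (p≡ _)

  at-split : (U V : Sequent) (μ : Occ (U ⊕ V)) → (U ⊕ V) at μ ≡ [ U at_ , V at_ ]′ (split U V μ)
  at-split U V (inj₁ i) rewrite Vecₚ.lookup-splitAt (#ante U) (ante U) (ante V) i
    with splitAt (#ante U) i
  ... | inj₁ _ = refl
  ... | inj₂ _ = refl
  at-split U V (inj₂ i) rewrite Vecₚ.lookup-splitAt (#succ U) (succ U) (succ V) i
    with splitAt (#succ U) i
  ... | inj₁ _ = refl
  ... | inj₂ _ = refl

  at-locate : (U V : Sequent) {S : Sequent} (e : S ≋ U ⊕ V) (μ : Occ S) →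
              S at μ ≡ [ U at_ , V at_ ]′ (locate U V e μ)
  at-locate U V e μ = trans (at-move e μ) (at-split U V (move e μ))

  at-inˡ : (U V : Sequent) (μ : Occ U) → (U ⊕ V) at inˡ U V μ ≡ U at μ
  at-inˡ U V (inj₁ i) = Vecₚ.lookup-++ˡ (ante U) (ante V) i
  at-inˡ U V (inj₂ i) = Vecₚ.lookup-++ˡ (succ U) (succ V) i

  at-inʳ : (U V : Sequent) (μ : Occ V) → (U ⊕ V) at inʳ U V μ ≡ V at μ
  at-inʳ U V (inj₁ i) = Vecₚ.lookup-++ʳ (ante U) (ante V) i
  at-inʳ U V (inj₂ i) = Vecₚ.lookup-++ʳ (succ U) (succ V) i

  at-mapˢ : (f : Form 0 → Form 0) (S : Sequent) (μ : Occ S) → mapˢ f S at μ ≡ f (S at μ)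
  at-mapˢ f S (inj₁ i) = Vecₚ.lookup-map i f (ante S)
  at-mapˢ f S (inj₂ i) = Vecₚ.lookup-map i f (succ S)

  at-mapˢ-atom : {B : Set} {f : B → Atom 0} (S : Seqt B) (μ : Occ S) →
                 QF (mapˢ (λ b → atom (f b)) S at μ)
  at-mapˢ-atom {f = f} S (inj₁ i) = subst QF (sym (Vecₚ.lookup-map i (λ b → atom (f b)) (ante S))) _
  at-mapˢ-atom {f = f} S (inj₂ i) = subst QF (sym (Vecₚ.lookup-map i (λ b → atom (f b)) (succ S))) _

  axiom-QF : ∀ {C S} → Axiom C S → ∀ μ → QF (S at μ)
  axiom-QF (tautology 𝒜 e _) μ = subst QF (sym (at-move e μ)) (at-mapˢ-atom {f = id} 𝒜 (move e μ))
  axiom-QF (equality 𝒜 e _)  μ = subst QF (sym (at-move e μ)) (at-mapˢ-atom {f = id} 𝒜 (move e μ))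
  axiom-QF (condition 𝒞 e _) μ = subst QF (sym (at-move e μ)) (at-mapˢ-atom 𝒞 (move e μ))

  -- Paths reduced to formulas and instances.

  module _ {Ax : Sequent → Set₁} {Call : Sequent → Set} where

    infix 4 _≼_

    -- Fixes the module parameters of `_⊑_`, which cannot be inferred from the formulas.
    _≼_ : Form n → Form n → Set
    _≼_ = _⊑_ {Ax} {Call}

    -- The effect of one inference on the traced formula, labelled with the instance. Context
    -- formulas, contraction and propositional rules all count as `subformula`.
    data Step (B A : Form 0) : Maybe (Term 0) → Set where
      subformula : A ≼ B → Step B A nothing
      instantiate : ∀ {C t} → B ≡ quant q C → A ≡ C ⟦ t ∷ [] ⟧ → Step B A (just t)

    -- What remains of a path when the derivation is forgotten: its yield and its
    -- instances (outermost quantifier last).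

    data Trail : Form 0 → List (Form 0) → List (Term 0) → Form 0 → Set where
      stop : ∀ {A} → Trail A (A ∷ []) [] A
      step : ∀ {A B C As ts x} → Step C B x → Trail B As ts A → Trail C (C ∷ As) (snoc ts x) A

    unary-step : ∀ {Γ A P} (r : Unary Γ A P) a b → Step (P at a) (A at b) (instance-term {Ax} {Call} r)
    unary-step (weakenˡ A)    a (inj₁ ())
    unary-step (weakenˡ A)    a (inj₂ ())
    unary-step (weakenʳ A)    a (inj₁ ())
    unary-step (weakenʳ A)    a (inj₂ ())
    unary-step (contractˡ A)  (inj₁ zero) (inj₁ zero)       = subformula ⊑-refl
    unary-step (contractˡ A)  (inj₁ zero) (inj₁ (suc zero)) = subformula ⊑-refl
    unary-step (contractʳ A)  (inj₂ zero) (inj₂ zero)       = subformula ⊑-refl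
    unary-step (contractʳ A)  (inj₂ zero) (inj₂ (suc zero)) = subformula ⊑-refl
    unary-step (¬ˡ A)         (inj₁ zero) (inj₂ zero) = subformula (⊑-~ ⊑-refl)
    unary-step (¬ʳ A)         (inj₂ zero) (inj₁ zero) = subformula (⊑-~ ⊑-refl)
    unary-step (∧ˡ₁ A B)      (inj₁ zero) (inj₁ zero) = subformula (⊑-∧₁ ⊑-refl)
    unary-step (∧ˡ₂ A B)      (inj₁ zero) (inj₁ zero) = subformula (⊑-∧₂ ⊑-refl)
    unary-step (∨ʳ₁ A B)      (inj₂ zero) (inj₂ zero) = subformula (⊑-∨₁ ⊑-refl)
    unary-step (∨ʳ₂ A B)      (inj₂ zero) (inj₂ zero) = subformula (⊑-∨₂ ⊑-refl)
    unary-step (→ʳ A B)       (inj₂ zero) (inj₁ zero) = subformula (⊑-⇒₁ ⊑-refl)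
    unary-step (→ʳ A B)       (inj₂ zero) (inj₂ zero) = subformula (⊑-⇒₂ ⊑-refl)
    unary-step (∀ˡ A t)       (inj₁ zero) (inj₁ zero) = instantiate refl refl
    unary-step (∃ʳ A t)       (inj₂ zero) (inj₂ zero) = instantiate refl refl
    unary-step (∀ʳ A y _ _)   (inj₂ zero) (inj₂ zero) = instantiate refl refl
    unary-step (∃ˡ A y _ _)   (inj₁ zero) (inj₁ zero) = instantiate refl refl

    binary-step₁ : ∀ {A₁ A₂ P} → Binary A₁ A₂ P → ∀ a b → Step (P at a) (A₁ at b) nothing
    binary-step₁ (∧ʳ A B) (inj₂ zero) (inj₂ zero) = subformula (⊑-∧₁ ⊑-refl)
    binary-step₁ (∨ˡ A B) (inj₁ zero) (inj₁ zero) = subformula (⊑-∨₁ ⊑-refl)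
    binary-step₁ (→ˡ A B) (inj₁ zero) (inj₂ zero) = subformula (⊑-⇒₁ ⊑-refl)
    binary-step₁ (cut A)  (inj₁ ()) _
    binary-step₁ (cut A)  (inj₂ ()) _

    binary-step₂ : ∀ {A₁ A₂ P} → Binary A₁ A₂ P → ∀ a b → Step (P at a) (A₂ at b) nothing
    binary-step₂ (∧ʳ A B) (inj₂ zero) (inj₂ zero) = subformula (⊑-∧₂ ⊑-refl)
    binary-step₂ (∨ˡ A B) (inj₁ zero) (inj₁ zero) = subformula (⊑-∨₂ ⊑-refl)
    binary-step₂ (→ˡ A B) (inj₁ zero) (inj₁ zero) = subformula (⊑-⇒₂ ⊑-refl)
    binary-step₂ (cut A)  (inj₁ ()) _
    binary-step₂ (cut A)  (inj₂ ()) _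

    Ancestorᵈ : ∀ {P A Γ Δ S T} → (Occ Δ → Occ Γ) → S ≋ P ⊕ Γ → T ≋ A ⊕ Δ → Occ S → Occ T → Set
    Ancestorᵈ {P} {A} {Γ} {Δ} = Ancestor {Ax} {Call} {P} {A} {Γ} {Δ}

    -- A quantifier inference contributes an instance only to paths through its principal formula.
    ancestor-label : ∀ {P A Γ Δ S T ι} {e : S ≋ P ⊕ Γ} {e′ : T ≋ A ⊕ Δ} {μ κ} →
                     Maybe (Term 0) → Ancestorᵈ {P} {A} {Γ} {Δ} ι e e′ μ κ → Maybe (Term 0)
    ancestor-label x (principal _ _) = x
    ancestor-label x (context _ _)   = nothing

    label-nothing : ∀ {P A Γ Δ S T ι} {e : S ≋ P ⊕ Γ} {e′ : T ≋ A ⊕ Δ} {μ κ}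
                    (anc : Ancestorᵈ {P} {A} {Γ} {Δ} ι e e′ μ κ) → ancestor-label nothing anc ≡ nothing
    label-nothing (principal _ _) = refl
    label-nothing (context _ _)   = refl

    ancestor-step : ∀ {P A Γ Δ S T} {ι : Occ Δ → Occ Γ} {e : S ≋ P ⊕ Γ} {e′ : T ≋ A ⊕ Δ} {μ κ x} →
                    (∀ a b → Step (P at a) (A at b) x) → (∀ c → Γ at ι c ≡ Δ at c) →
                    (anc : Ancestorᵈ {P} {A} {Γ} {Δ} ι e e′ μ κ) →
                    Step (S at μ) (T at κ) (ancestor-label x anc)
    ancestor-step {P} {A} {Γ} {Δ} {e = e} {e′} {μ} {κ} aux≼ ctx≡ (principal {a} {b} μ≡a κ≡b)
      rewrite at-locate P Γ e μ | μ≡a | at-locate A Δ e′ κ | κ≡b = aux≼ a b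
    ancestor-step {P} {A} {Γ} {Δ} {e = e} {e′} {μ} {κ} aux≼ ctx≡ (context {c} μ≡c κ≡c)
      rewrite at-locate P Γ e μ | μ≡c | at-locate A Δ e′ κ | κ≡c | ctx≡ c = subformula ⊑-refl

    -- Replaces the `with` in `instances` by an equation that can be rewritten with.
    instances-up : ∀ {Γ A P S T U} (r : Unary Γ A P) {e : S ≋ P ⊕ Γ} {e′ : T ≋ A ⊕ Γ} {d : Deriv Ax Call T}
                   {μ κ} {d′ : Deriv Ax Call U} {ν} (anc : Ancestorᵈ {P} {A} {Γ} id e e′ μ κ)
                   (π : Path d κ d′ ν) →
                   instances (up {r = r} anc π) ≡ snoc (instances π) (ancestor-label (instance-term {Ax} {Call} r) anc)
    instances-up r (principal _ _) π with instance-term {Ax} {Call} r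
    ... | just _  = refl
    ... | nothing = refl
    instances-up r (context _ _)   π = refl

    trail : ∀ {S U} {d : Deriv Ax Call S} {μ} {d′ : Deriv Ax Call U} {ν} (π : Path d μ d′ ν) →
            Trail (S at μ) (yield π) (instances π) (U at ν)
    trail stop = stop
    trail (up {r = r} anc π) rewrite instances-up r anc π =
      step (ancestor-step (unary-step r) (λ _ → refl) anc) (trail π)
    trail (left {Γ₁} {Γ₂} {r = r} anc π) =
      step (subst (Step _ _) (label-nothing anc) (ancestor-step (binary-step₁ r) (at-inˡ Γ₁ Γ₂) anc)) (trail π)
    trail (right {Γ₁} {Γ₂} {r = r} anc π) =
      step (subst (Step _ _) (label-nothing anc) (ancestor-step (binary-step₂ r) (at-inʳ Γ₁ Γ₂) anc)) (trail π)

    ≼-trans : ∀ {A B C : Form n} → A ≼ B → B ≼ C → A ≼ C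
    ≼-trans A≼B ⊑-refl       = A≼B
    ≼-trans A≼B (⊑-~ B≼C)    = ⊑-~ (≼-trans A≼B B≼C)
    ≼-trans A≼B (⊑-∧₁ B≼C)   = ⊑-∧₁ (≼-trans A≼B B≼C)
    ≼-trans A≼B (⊑-∧₂ B≼C)   = ⊑-∧₂ (≼-trans A≼B B≼C)
    ≼-trans A≼B (⊑-∨₁ B≼C)   = ⊑-∨₁ (≼-trans A≼B B≼C)
    ≼-trans A≼B (⊑-∨₂ B≼C)   = ⊑-∨₂ (≼-trans A≼B B≼C)
    ≼-trans A≼B (⊑-⇒₁ B≼C)   = ⊑-⇒₁ (≼-trans A≼B B≼C)
    ≼-trans A≼B (⊑-⇒₂ B≼C)   = ⊑-⇒₂ (≼-trans A≼B B≼C)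

    QF-≼ : ∀ {A B : Form n} → A ≼ B → QF B → QF A
    QF-≼ ⊑-refl     qf      = qf
    QF-≼ (⊑-~ A≼)   qf      = QF-≼ A≼ qf
    QF-≼ (⊑-∧₁ A≼)  (b , _) = QF-≼ A≼ b
    QF-≼ (⊑-∧₂ A≼)  (_ , c) = QF-≼ A≼ c
    QF-≼ (⊑-∨₁ A≼)  (b , _) = QF-≼ A≼ b
    QF-≼ (⊑-∨₂ A≼)  (_ , c) = QF-≼ A≼ c
    QF-≼ (⊑-⇒₁ A≼)  (b , _) = QF-≼ A≼ b
    QF-≼ (⊑-⇒₂ A≼)  (_ , c) = QF-≼ A≼ c

    #quants-≼ : ∀ {A B : Form n} → A ≼ B → #quants A ≤ #quants B
    #quants-≼ ⊑-refl     = ≤-refl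
    #quants-≼ (⊑-~ A≼)   = #quants-≼ A≼
    #quants-≼ (⊑-∧₁ A≼)  = m≤n⇒m≤n+o _ (#quants-≼ A≼)
    #quants-≼ (⊑-∧₂ A≼)  = m≤n⇒m≤o+n _ (#quants-≼ A≼)
    #quants-≼ (⊑-∨₁ A≼)  = m≤n⇒m≤n+o _ (#quants-≼ A≼)
    #quants-≼ (⊑-∨₂ A≼)  = m≤n⇒m≤o+n _ (#quants-≼ A≼)
    #quants-≼ (⊑-⇒₁ A≼)  = m≤n⇒m≤n+o _ (#quants-≼ A≼)
    #quants-≼ (⊑-⇒₂ A≼)  = m≤n⇒m≤o+n _ (#quants-≼ A≼)

    -- Every instantiation uses up one quantifier, and no step adds one.
    trail-#quants : ∀ {A B As ts} → Trail B As ts A → #quants A + List.length ts ≤ #quants B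
    trail-#quants {A} stop = ≤-reflexive (+-identityʳ (#quants A))
    trail-#quants (step (subformula B≼C) π) = ≤-trans (trail-#quants π) (#quants-≼ B≼C)
    trail-#quants {A} (step {ts = ts} (instantiate {C = C} {t} refl refl) π) = begin
      #quants A + List.length (ts ∷ʳ t)  ≡⟨ cong (#quants A +_) (Listₚ.length-++ ts) ⟩
      #quants A + (List.length ts + 1)   ≡⟨ +-assoc (#quants A) (List.length ts) 1 ⟨
      #quants A + List.length ts + 1     ≤⟨ +-monoˡ-≤ 1 (trail-#quants π) ⟩
      #quants (C ⟦ t ∷ [] ⟧) + 1         ≡⟨ +-comm _ 1 ⟩
      suc (#quants (C ⟦ t ∷ [] ⟧))       ≡⟨ cong suc (#quants-sub (lookup (t ∷ [])) C) ⟩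
      suc (#quants C)                    ∎
      where open ≤-Reasoning

    -- An instance would cost a quantifier that the final formula still has. This serves the clause
    -- `untouched` of `Θ*`, which compares formulas only.
    loop-instances : ∀ {A As ts} → Trail A As ts A → ts ≡ []
    loop-instances {ts = []}     π = refl
    loop-instances {A} {ts = t ∷ ts} π = contradiction (trail-#quants π) (m+1+n≰m (#quants A))

    -- Subformulas of a quantifier-free formula are quantifier-free, so no instantiation step can
    -- occur.
    QF-trail : ∀ {A B As ts} → QF B → Trail B As ts A → B ∈ As × A ≼ B × ts ≡ []
    QF-trail qf stop = here refl , ⊑-refl , refl
    QF-trail qf (step (subformula B≼C) π) with QF-trail (QF-≼ B≼C qf) π
    ... | _ , A≼B , refl = here refl , ≼-trans A≼B B≼C , refl
    QF-trail () (step (instantiate refl _) π)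

    -- The alternatives in the definition of hi at a call, detached from how the path ends. `β` is
    -- fixed from outside, so its splitting is an equation and `F` is transported along it.
    data View (q : Quantifier) {β} (F : Form β) (As : List (Form 0)) (ts : List (Term 0)) (A : Form 0) : Set where
      untouched : 1 ≤ β → ts ≡ [] → A ≡ quants q F → View q F As ts A
      partial   : ∀ {i} → 1 ≤ k → 1 ≤ i → (e : β ≡ k + i) (θ : Vec (Term 0) i) → Vec.toList θ ≡ ts →
                  A ≡ quants q (partially k (subst Form e F) θ) → View q F As ts A
      complete  : (θ : Vec (Term 0) β) → Vec.toList θ ≡ ts → F ⟦ θ ⟧ ∈ As → A ≼ F ⟦ θ ⟧ → View q F As ts A

    -- Induction on `β`: the first instantiation turns `F` into a matrix with one variable fewer;
    -- its term is the outermost and is appended to the substitution found for the rest.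
    view : ∀ {q β} (F : Form β) → QF F → ∀ {As ts A} → Trail (quants q F) As ts A → View q F As ts A
    view {β = zero} F qf π with QF-trail qf π
    ... | F∈ , A≼ , refl = complete [] refl (subst (_∈ _) F≡ F∈) (subst (_ ≼_) F≡ A≼)
      where F≡ = sym (sub-id (λ ()) F)
    view {q} {suc β} F qf π = go π refl
      where
      go : ∀ {B As ts A} → Trail B As ts A → B ≡ quants q F → View q F As ts A
      go stop B≡ = untouched (s≤s z≤n) refl B≡
      -- Exposing the outermost quantifier leaves only `⊑-refl`: no constructor of `_⊑_` goes below
      -- a quantifier.
      go (step (subformula B≼C) π) C≡ with trans C≡ (quants-suc F)
      go (step (subformula ⊑-refl) π) C≡ | refl with go π C≡
      ... | untouched 1≤β ts≡ A≡     = untouched 1≤β ts≡ A≡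
      ... | partial 1≤k 1≤i e θ θ≡ A≡ = partial 1≤k 1≤i e θ θ≡ A≡
      ... | complete θ θ≡ F∈ A≼       = complete θ θ≡ (there F∈) A≼
      go (step (instantiate refl refl) π) C≡ with trans C≡ (quants-suc F)
      go (step (instantiate {t = t} refl refl) π) C≡ | refl
        rewrite quants₁-⟦⟧ {q = q} F t
        with view (sub (outermost t) F) (QF-sub _ F qf) π
      -- Only x₁ has been instantiated, so `k` is `β` and `i` is 1.
      ... | untouched 1≤β refl refl =
        partial 1≤β (s≤s z≤n) (sym (+-comm β 1)) (t ∷ []) refl
          (cong (quants q) (trans (partially-[] F t) (sym (partially-subst (sym (+-comm β 1)) F (t ∷ [])))))
      ... | partial {k} {i} 1≤k 1≤i refl θ refl refl =
        partial 1≤k (s≤s z≤n) (sym (+-suc k i)) (θ Vec.∷ʳ t) (Vecₚ.toList-∷ʳ t θ)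
          (cong (quants q) (trans (partially-∷ʳ F θ t) (sym (partially-subst (sym (+-suc k i)) F (θ Vec.∷ʳ t)))))
      ... | complete θ refl F∈ A≼ rewrite ⟦⟧-∷ʳ F θ t =
        complete (θ Vec.∷ʳ t) (Vecₚ.toList-∷ʳ t θ) (there F∈) A≼

  -- Paths up to a given formula.

  callsIn : ∀ {Ax Call S U V} {d : Deriv Ax Call S} {μ} {d′ : Deriv Ax Call U} {ν} {c : Call V} →
            Path d μ d′ ν → CallsIn d′ c → CallsIn d c
  callsIn stop        c∈ = c∈
  callsIn (up _ π)    c∈ = up (callsIn π c∈)
  callsIn (left _ π)  c∈ = left (callsIn π c∈)
  callsIn (right _ π) c∈ = right (callsIn π c∈)

  -- The subproof at which the path stops is hidden, because a conversion of the end-sequent may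
  -- change it; the final formula and the instances stay.
  PathTo : ∀ {Ax Call S} → Deriv Ax Call S → Occ S → Form 0 → List (Term 0) → Set₁
  PathTo {Ax} {Call} d μ A ts =
    ∃[ T ] Σ[ d′ ∈ Deriv Ax Call T ] ∃[ ν ] Σ[ π ∈ Path d μ d′ ν ] T at ν ≡ A × ts ≡ instances π

  -- No instances follow a quantifier-free formula.

  path-to-QF : ∀ {Ax Call S U A} {d : Deriv Ax Call S} {μ} {d′ : Deriv Ax Call U} {ν} (π : Path d μ d′ ν) →
               A ∈ yield π → QF A → PathTo d μ A (instances π)
  path-to-QF {Ax} {Call} {A = A} = from
    where
    at-once : ∀ {S U} {d : Deriv Ax Call S} {μ} {d′ : Deriv Ax Call U} {ν} (π : Path d μ d′ ν) →
              A ≡ S at μ → QF A → PathTo d μ A (instances π)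
    at-once π A≡ qf with QF-trail (subst QF A≡ qf) (trail π)
    ... | _ , _ , ts≡ = _ , _ , _ , stop , sym A≡ , ts≡

    from : ∀ {S U} {d : Deriv Ax Call S} {μ} {d′ : Deriv Ax Call U} {ν} (π : Path d μ d′ ν) →
           A ∈ yield π → QF A → PathTo d μ A (instances π)
    from π@stop        (here A≡)  qf = at-once π A≡ qf
    from π@(up _ _)    (here A≡)  qf = at-once π A≡ qf
    from π@(left _ _)  (here A≡)  qf = at-once π A≡ qf
    from π@(right _ _) (here A≡)  qf = at-once π A≡ qf
    from (up {r = r} anc π) (there A∈) qf with from π A∈ qf
    ... | _ , _ , _ , π′ , A≡ , ts≡ = _ , _ , _ , up anc π′ , A≡ ,
      trans (instances-up r anc π)
            (trans (cong (λ ts → snoc ts (ancestor-label (instance-term {Ax} {Call} r) anc)) ts≡)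
                   (sym (instances-up r anc π′)))
    from (left anc π)  (there A∈) qf with from π A∈ qf
    ... | _ , _ , _ , π′ , A≡ , ts≡ = _ , _ , _ , left anc π′ , A≡ , ts≡
    from (right anc π) (there A∈) qf with from π A∈ qf
    ... | _ , _ , _ , π′ , A≡ , ts≡ = _ , _ , _ , right anc π′ , A≡ , ts≡

  -- Paths in a grafted derivation.

  snoc-map : (f : Term 0 → Term 0) (ts us : List (Term 0)) (x : Maybe (Term 0)) →
             snoc (ts List.++ List.map f us) (Maybe.map f x) ≡ ts List.++ List.map f (snoc us x)
  snoc-map f ts us nothing  = refl
  snoc-map f ts us (just t) =
    trans (Listₚ.++-assoc ts (List.map f us) _) (cong (ts List.++_) (sym (Listₚ.map-++ f us (t ∷ []))))

  module _ {Ax Ax′ : Sequent → Set₁} {Call Call′ : Sequent → Set} (σ : Assignment)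
           (ax : ∀ {T} → Ax T → Ax′ (applyˢ σ T)) where

    -- For the quantifier rules `unary-apply` is itself defined by rewriting with `psub-⟦⟧`; the
    -- same rewriting makes it compute.
    instance-apply : ∀ {Γ A P} (r : Unary Γ A P) →
                     instance-term {Ax′} {Call′} (unary-apply σ r) ≡
                     Maybe.map (applyᵗ σ) (instance-term {Ax} {Call} r)
    instance-apply (weakenˡ A)   = refl
    instance-apply (weakenʳ A)   = refl
    instance-apply (contractˡ A) = refl
    instance-apply (contractʳ A) = refl
    instance-apply (¬ˡ A)        = refl
    instance-apply (¬ʳ A)        = refl
    instance-apply (∧ˡ₁ A B)     = refl
    instance-apply (∧ˡ₂ A B)     = refl
    instance-apply (∨ʳ₁ A B)     = refl
    instance-apply (∨ʳ₂ A B)     = refl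
    instance-apply (→ʳ A B)      = refl
    instance-apply (∀ˡ A t)      rewrite psub-⟦⟧ (asParSub σ) A (t ∷ [])          = refl
    instance-apply (∃ʳ A t)      rewrite psub-⟦⟧ (asParSub σ) A (t ∷ [])          = refl
    instance-apply (∀ʳ A y _ _)  rewrite psub-⟦⟧ (asParSub σ) A (⌈ fvar y ⌉ ∷ []) = refl
    instance-apply (∃ˡ A y _ _)  rewrite psub-⟦⟧ (asParSub σ) A (⌈ fvar y ⌉ ∷ []) = refl

    Continuation : ∀ {S} → Deriv Ax Call S → Set₁
    Continuation d = ∀ {T} {c : Call T} → CallsIn d c → Deriv Ax′ Call′ (applyˢ σ T)

    -- Serves both directions, image and preimage of a path: the ancestor steps `anc` and `anc′` are
    -- given independently, and `label≡` says that both are principal or both are context steps.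
    snoc-instance : ∀ {Γ A P S T U V} (r : Unary Γ A P) {e : S ≋ P ⊕ Γ} {e′ : T ≋ A ⊕ Γ} {d : Deriv Ax Call T}
                    {μ κ} {d′ : Deriv Ax Call U} {ν}
                    {f : applyˢ σ S ≋ applyˢ σ P ⊕ applyˢ σ Γ} {f′ : applyˢ σ T ≋ applyˢ σ A ⊕ applyˢ σ Γ}
                    {g : Deriv Ax′ Call′ (applyˢ σ T)} {g′ : Deriv Ax′ Call′ V} {ξ} {ts}
                    (anc : Ancestorᵈ {P = P} {A} {Γ} {Γ} id e e′ μ κ) (τ : Path d κ d′ ν)
                    (anc′ : Ancestorᵈ {P = applyˢ σ P} {applyˢ σ A} {applyˢ σ Γ} {applyˢ σ Γ} id f f′ μ κ)
                    (π : Path g κ g′ ξ) →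
                    (∀ x → ancestor-label (Maybe.map (applyᵗ σ) x) anc′ ≡ Maybe.map (applyᵗ σ) (ancestor-label x anc)) →
                    instances π ≡ ts List.++ List.map (applyᵗ σ) (instances τ) →
                    instances (up {r = unary-apply σ r} anc′ π) ≡
                    ts List.++ List.map (applyᵗ σ) (instances (up {r = r} anc τ))
    snoc-instance r {ts = ts} anc τ anc′ π label≡ π≡ = begin
      instances (up {r = unary-apply σ r} anc′ π)
        ≡⟨ instances-up (unary-apply σ r) anc′ π ⟩
      snoc (instances π) (ancestor-label (instance-term {Ax′} {Call′} (unary-apply σ r)) anc′)
        ≡⟨ cong₂ snoc π≡ (trans (cong (λ x → ancestor-label x anc′) (instance-apply r)) (label≡ _)) ⟩
      snoc (ts List.++ List.map (applyᵗ σ) (instances τ))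
           (Maybe.map (applyᵗ σ) (ancestor-label (instance-term {Ax} {Call} r) anc))
        ≡⟨ snoc-map (applyᵗ σ) ts (instances τ) (ancestor-label (instance-term {Ax} {Call} r) anc) ⟩
      ts List.++ List.map (applyᵗ σ) (snoc (instances τ) (ancestor-label (instance-term {Ax} {Call} r) anc))
        ≡⟨ cong (λ us → ts List.++ List.map (applyᵗ σ) us) (instances-up r anc τ) ⟨
      ts List.++ List.map (applyᵗ σ) (instances (up {r = r} anc τ)) ∎
      where open ≡-Reasoning

    -- `σ` changes formulas but not positions; once the side of `μ` is known, both sides compute to
    -- the same occurrence.
    locate-⊕ : ∀ U V {S} (e : S ≋ U ⊕ V) μ →
               locate (applyˢ σ U) (applyˢ σ V) (mapˢ-≋-⊕ (apply σ) U V e) μ ≡ locate U V e μ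
    locate-⊕ U V e (inj₁ i) = refl
    locate-⊕ U V e (inj₂ i) = refl

    locate-⊕-⊕ : ∀ U V W {S} (e : S ≋ U ⊕ V ⊕ W) μ →
                 locate (applyˢ σ U) (applyˢ σ V ⊕ applyˢ σ W) (mapˢ-≋-⊕-⊕ (apply σ) U V W e) μ ≡
                 locate U (V ⊕ W) e μ
    locate-⊕-⊕ U V W e (inj₁ i) = refl
    locate-⊕-⊕ U V W e (inj₂ i) = refl

    -- Quantifiers are consumed from the outside in, so the instances of the continuation `π` are
    -- inner ones and come in front.
    graft-path : ∀ {S U V} {d : Deriv Ax Call S} {μ} {d′ : Deriv Ax Call U} {ν} {g : Deriv Ax′ Call′ V} {ν′}
                 (κ : Continuation d) (τ : Path d μ d′ ν) (π : Path (graft σ ax d′ (κ ∘ callsIn τ)) ν g ν′) →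
                 Σ[ π′ ∈ Path (graft σ ax d κ) μ g ν′ ]
                   instances π′ ≡ instances π List.++ List.map (applyᵗ σ) (instances τ)
    graft-path κ stop π = π , sym (Listₚ.++-identityʳ _)
    graft-path κ (up {Γ} {A} {P} {r = r} {e} {e′} {μ = μ} {κ = ν} anc@(principal μ≡ ν≡) τ) π with graft-path (κ ∘ up) τ π
    ... | π′ , π′≡ =
      let anc′ = principal (trans (locate-⊕ P Γ e μ) μ≡) (trans (locate-⊕ A Γ e′ ν) ν≡)
      in up anc′ π′ , snoc-instance r anc τ anc′ π′ (λ _ → refl) π′≡
    graft-path κ (up {Γ} {A} {P} {r = r} {e} {e′} {μ = μ} {κ = ν} anc@(context μ≡ ν≡) τ) π with graft-path (κ ∘ up) τ π
    ... | π′ , π′≡ =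
      let anc′ = context (trans (locate-⊕ P Γ e μ) μ≡) (trans (locate-⊕ A Γ e′ ν) ν≡)
      in up anc′ π′ , snoc-instance r anc τ anc′ π′ (λ _ → refl) π′≡
    graft-path κ (left {Γ₁} {Γ₂} {A₁} {A₂} {P} {e = e} {e₁} {e₂} {μ = μ} {κ = ν} (principal μ≡ ν≡) τ) π
      with graft-path (κ ∘ left) τ π
    ... | π′ , π′≡ =
      left (principal (trans (locate-⊕-⊕ P Γ₁ Γ₂ e μ) μ≡) (trans (locate-⊕ A₁ Γ₁ e₁ ν) ν≡)) π′ , π′≡
    graft-path κ (left {Γ₁} {Γ₂} {A₁} {A₂} {P} {e = e} {e₁} {e₂} {μ = μ} {κ = ν} (context μ≡ ν≡) τ) π
      with graft-path (κ ∘ left) τ π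
    ... | π′ , π′≡ =
      left (context (trans (locate-⊕-⊕ P Γ₁ Γ₂ e μ) μ≡) (trans (locate-⊕ A₁ Γ₁ e₁ ν) ν≡)) π′ , π′≡
    graft-path κ (right {Γ₁} {Γ₂} {A₁} {A₂} {P} {e = e} {e₁} {e₂} {μ = μ} {κ = ν} (principal μ≡ ν≡) τ) π
      with graft-path (κ ∘ right) τ π
    ... | π′ , π′≡ =
      right (principal (trans (locate-⊕-⊕ P Γ₁ Γ₂ e μ) μ≡) (trans (locate-⊕ A₂ Γ₂ e₂ ν) ν≡)) π′ , π′≡
    graft-path κ (right {Γ₁} {Γ₂} {A₁} {A₂} {P} {e = e} {e₁} {e₂} {μ = μ} {κ = ν} (context μ≡ ν≡) τ) π
      with graft-path (κ ∘ right) τ π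
    ... | π′ , π′≡ =
      right (context (trans (locate-⊕-⊕ P Γ₁ Γ₂ e μ) μ≡) (trans (locate-⊕ A₂ Γ₂ e₂ ν) ν≡)) π′ , π′≡

    -- In `toCall`, `π` is the rest of the trace, inside the proof grafted in at the call; `τ`
    -- belongs to the s-proof, hence `σ` is applied to its instances alone.
    data Factored {S} (d : Deriv Ax Call S) (κ : Continuation d) (μ : Occ S) (ts : List (Term 0)) : Set₁ where
      toAxiom : ∀ {U} {a : Ax U} {ν} (τ : Path d μ (axiom a) ν) →
                ts ≡ List.map (applyᵗ σ) (instances τ) → Factored d κ μ ts
      toCall  : ∀ {U V} {c : Call U} {ν} {a : Ax′ V} {ν′}
                (τ : Path d μ (call c) ν) (π : Path (κ (callsIn τ here)) ν (axiom a) ν′) →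
                ts ≡ instances π List.++ List.map (applyᵗ σ) (instances τ) → Factored d κ μ ts

    -- Converse of `graft-path` for traces: `graft` preserves the shape of `d`, so the trace follows
    -- `d` up to a leaf.
    factor : ∀ {S V} (d : Deriv Ax Call S) (κ : Continuation d) {μ} {a : Ax′ V} {ν}
             (π : Path (graft σ ax d κ) μ (axiom a) ν) → Factored d κ μ (instances π)
    factor (axiom a) κ stop = toAxiom stop refl
    factor (call c)  κ π    = toCall stop π (sym (Listₚ.++-identityʳ _))
    factor (unary {Γ} {A} {P} r e e′ d) κ (up {μ = μ} {κ = ν} anc@(principal μ≡ ν≡) π) with factor d (κ ∘ up) π
    ... | toAxiom τ π≡   =
      let anc′ = principal (trans (sym (locate-⊕ P Γ e μ)) μ≡) (trans (sym (locate-⊕ A Γ e′ ν)) ν≡)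
      in toAxiom (up anc′ τ) (snoc-instance r anc′ τ anc π (λ _ → refl) π≡)
    ... | toCall τ π′ π≡ =
      let anc′ = principal (trans (sym (locate-⊕ P Γ e μ)) μ≡) (trans (sym (locate-⊕ A Γ e′ ν)) ν≡)
      in toCall (up anc′ τ) π′ (snoc-instance r anc′ τ anc π (λ _ → refl) π≡)
    factor (unary {Γ} {A} {P} r e e′ d) κ (up {μ = μ} {κ = ν} anc@(context μ≡ ν≡) π) with factor d (κ ∘ up) π
    ... | toAxiom τ π≡   =
      let anc′ = context (trans (sym (locate-⊕ P Γ e μ)) μ≡) (trans (sym (locate-⊕ A Γ e′ ν)) ν≡)
      in toAxiom (up anc′ τ) (snoc-instance r anc′ τ anc π (λ _ → refl) π≡)
    ... | toCall τ π′ π≡ =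
      let anc′ = context (trans (sym (locate-⊕ P Γ e μ)) μ≡) (trans (sym (locate-⊕ A Γ e′ ν)) ν≡)
      in toCall (up anc′ τ) π′ (snoc-instance r anc′ τ anc π (λ _ → refl) π≡)
    factor (binary {Γ₁} {Γ₂} {A₁} {A₂} {P} r e e₁ e₂ d₁ d₂) κ (left {μ = μ} {κ = ν} (principal μ≡ ν≡) π)
      with factor d₁ (κ ∘ left) π
    ... | toAxiom τ π≡   =
      toAxiom (left (principal (trans (sym (locate-⊕-⊕ P Γ₁ Γ₂ e μ)) μ≡) (trans (sym (locate-⊕ A₁ Γ₁ e₁ ν)) ν≡)) τ) π≡
    ... | toCall τ π′ π≡ =
      toCall (left (principal (trans (sym (locate-⊕-⊕ P Γ₁ Γ₂ e μ)) μ≡) (trans (sym (locate-⊕ A₁ Γ₁ e₁ ν)) ν≡)) τ) π′ π≡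
    factor (binary {Γ₁} {Γ₂} {A₁} {A₂} {P} r e e₁ e₂ d₁ d₂) κ (left {μ = μ} {κ = ν} (context μ≡ ν≡) π)
      with factor d₁ (κ ∘ left) π
    ... | toAxiom τ π≡   =
      toAxiom (left (context (trans (sym (locate-⊕-⊕ P Γ₁ Γ₂ e μ)) μ≡) (trans (sym (locate-⊕ A₁ Γ₁ e₁ ν)) ν≡)) τ) π≡
    ... | toCall τ π′ π≡ =
      toCall (left (context (trans (sym (locate-⊕-⊕ P Γ₁ Γ₂ e μ)) μ≡) (trans (sym (locate-⊕ A₁ Γ₁ e₁ ν)) ν≡)) τ) π′ π≡
    factor (binary {Γ₁} {Γ₂} {A₁} {A₂} {P} r e e₁ e₂ d₁ d₂) κ (right {μ = μ} {κ = ν} (principal μ≡ ν≡) π)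
      with factor d₂ (κ ∘ right) π
    ... | toAxiom τ π≡   =
      toAxiom (right (principal (trans (sym (locate-⊕-⊕ P Γ₁ Γ₂ e μ)) μ≡) (trans (sym (locate-⊕ A₂ Γ₂ e₂ ν)) ν≡)) τ) π≡
    ... | toCall τ π′ π≡ =
      toCall (right (principal (trans (sym (locate-⊕-⊕ P Γ₁ Γ₂ e μ)) μ≡) (trans (sym (locate-⊕ A₂ Γ₂ e₂ ν)) ν≡)) τ) π′ π≡
    factor (binary {Γ₁} {Γ₂} {A₁} {A₂} {P} r e e₁ e₂ d₁ d₂) κ (right {μ = μ} {κ = ν} (context μ≡ ν≡) π)
      with factor d₂ (κ ∘ right) π
    ... | toAxiom τ π≡   =
      toAxiom (right (context (trans (sym (locate-⊕-⊕ P Γ₁ Γ₂ e μ)) μ≡) (trans (sym (locate-⊕ A₂ Γ₂ e₂ ν)) ν≡)) τ) π≡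
    ... | toCall τ π′ π≡ =
      toCall (right (context (trans (sym (locate-⊕-⊕ P Γ₁ Γ₂ e μ)) μ≡) (trans (sym (locate-⊕ A₂ Γ₂ e₂ ν)) ν≡)) τ) π′ π≡

    graft-PathTo : ∀ {S U} {d : Deriv Ax Call S} {μ} {d′ : Deriv Ax Call U} {ν A ts} {κ : Continuation d}
                   (τ : Path d μ d′ ν) → PathTo (graft σ ax d′ (κ ∘ callsIn τ)) ν A ts →
                   PathTo (graft σ ax d κ) μ A (ts List.++ List.map (applyᵗ σ) (instances τ))
    graft-PathTo {κ = κ} τ (_ , _ , _ , π , A≡ , refl) with graft-path κ τ π
    ... | π′ , π′≡ = _ , _ , _ , π′ , A≡ , sym π′≡

  -- Paths under a conversion of the end-sequent.

  locate-≋-trans : (U V : Sequent) {S T : Sequent} (e : T ≋ S) (e₀ : S ≋ U ⊕ V) (μ : Occ T) →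
                   locate U V (≋-trans e e₀) μ ≡ locate U V e₀ (move e μ)
  locate-≋-trans U V e e₀ (inj₁ i) = refl
  locate-≋-trans U V e e₀ (inj₂ i) = refl

  module _ {Ax : Sequent → Set₁} {Call : Sequent → Set} {S T : Sequent}
           {ax : Ax S → Ax T} {cl : Call S → Call T} (e : T ≋ S) where

    -- `convert` alters only the multiset conversion of the last inference, so all but the first
    -- ancestor step can be kept.
    convert-PathTo : ∀ {d : Deriv Ax Call S} {μ A ts} →
                     PathTo d (move e μ) A ts → PathTo (convert ax cl e d) μ A ts
    convert-PathTo {μ = μ} (_ , _ , _ , stop , A≡ , ts≡) =
      _ , _ , _ , stop , trans (at-move e μ) A≡ , ts≡
    convert-PathTo {μ = μ} (_ , _ , _ , up {Γ} {A} {P} {r = r} {e₀} (principal μ≡ κ≡) π , A≡ , ts≡) =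
      _ , _ , _ , up {r = r} (principal (trans (locate-≋-trans P Γ e e₀ μ) μ≡) κ≡) π , A≡ , ts≡
    convert-PathTo {μ = μ} (_ , _ , _ , up {Γ} {A} {P} {r = r} {e₀} (context μ≡ κ≡) π , A≡ , ts≡) =
      _ , _ , _ , up {r = r} (context (trans (locate-≋-trans P Γ e e₀ μ) μ≡) κ≡) π , A≡ , ts≡
    convert-PathTo {μ = μ} (_ , _ , _ , left {Γ₁} {Γ₂} {P = P} {e = e₀} (principal μ≡ κ≡) π , A≡ , ts≡) =
      _ , _ , _ , left (principal (trans (locate-≋-trans P (Γ₁ ⊕ Γ₂) e e₀ μ) μ≡) κ≡) π , A≡ , ts≡
    convert-PathTo {μ = μ} (_ , _ , _ , left {Γ₁} {Γ₂} {P = P} {e = e₀} (context μ≡ κ≡) π , A≡ , ts≡) =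
      _ , _ , _ , left (context (trans (locate-≋-trans P (Γ₁ ⊕ Γ₂) e e₀ μ) μ≡) κ≡) π , A≡ , ts≡
    convert-PathTo {μ = μ} (_ , _ , _ , right {Γ₁} {Γ₂} {P = P} {e = e₀} (principal μ≡ κ≡) π , A≡ , ts≡) =
      _ , _ , _ , right (principal (trans (locate-≋-trans P (Γ₁ ⊕ Γ₂) e e₀ μ) μ≡) κ≡) π , A≡ , ts≡
    convert-PathTo {μ = μ} (_ , _ , _ , right {Γ₁} {Γ₂} {P = P} {e = e₀} (context μ≡ κ≡) π , A≡ , ts≡) =
      _ , _ , _ , right (context (trans (locate-≋-trans P (Γ₁ ⊕ Γ₂) e e₀ μ) μ≡) κ≡) π , A≡ , ts≡

    -- Only paths ending in an axiom are pulled back. The final axiom may itself be the converted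
    -- one, so its preimage `a′` is quantified existentially.
    unconvert : ∀ {V} (d : Deriv Ax Call S) {μ} {a : Ax V} {ν} (π : Path (convert ax cl e d) μ (axiom a) ν) →
                ∃[ V′ ] Σ[ a′ ∈ Ax V′ ] ∃[ ν′ ] Σ[ π′ ∈ Path d (move e μ) (axiom a′) ν′ ] instances π ≡ instances π′
    unconvert (axiom _) stop = _ , _ , _ , stop , refl
    unconvert (unary {Γ} {P = P} r e₀ _ _) (up {μ = μ} (principal μ≡ κ≡) π) =
      _ , _ , _ , up (principal (trans (sym (locate-≋-trans P Γ e e₀ μ)) μ≡) κ≡) π , refl
    unconvert (unary {Γ} {P = P} r e₀ _ _) (up {μ = μ} (context μ≡ κ≡) π) =
      _ , _ , _ , up (context (trans (sym (locate-≋-trans P Γ e e₀ μ)) μ≡) κ≡) π , refl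
    unconvert (binary {Γ₁} {Γ₂} {P = P} r e₀ _ _ _ _) (left {μ = μ} (principal μ≡ κ≡) π) =
      _ , _ , _ , left (principal (trans (sym (locate-≋-trans P (Γ₁ ⊕ Γ₂) e e₀ μ)) μ≡) κ≡) π , refl
    unconvert (binary {Γ₁} {Γ₂} {P = P} r e₀ _ _ _ _) (left {μ = μ} (context μ≡ κ≡) π) =
      _ , _ , _ , left (context (trans (sym (locate-≋-trans P (Γ₁ ⊕ Γ₂) e e₀ μ)) μ≡) κ≡) π , refl
    unconvert (binary {Γ₁} {Γ₂} {P = P} r e₀ _ _ _ _) (right {μ = μ} (principal μ≡ κ≡) π) =
      _ , _ , _ , right (principal (trans (sym (locate-≋-trans P (Γ₁ ⊕ Γ₂) e e₀ μ)) μ≡) κ≡) π , refl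
    unconvert (binary {Γ₁} {Γ₂} {P = P} r e₀ _ _ _ _) (right {μ = μ} (context μ≡ κ≡) π) =
      _ , _ , _ , right (context (trans (sym (locate-≋-trans P (Γ₁ ⊕ Γ₂) e e₀ μ)) μ≡) κ≡) π , refl

  hi-instances : ∀ {Ax Call S U q β i} {F : Form β} {d : Deriv Ax Call S} {μ} {d′ : Deriv Ax Call U} {ν}
                 {τ : Path d μ d′ ν} {θ : Vec (Term 0) i} → Hi q F τ θ → Vec.toList θ ≡ instances τ
  hi-instances (atAxiom θ≡ _)      = θ≡
  hi-instances (untouched θ≡ _)    = θ≡
  hi-instances (partial _ _ θ≡ _)  = θ≡
  hi-instances (complete θ≡ _ _)   = θ≡

  path-view : ∀ {Ax Call S U q β} {F : Form β} {d : Deriv Ax Call S} {μ} {d′ : Deriv Ax Call U} {ν} →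
              QF F → S at μ ≡ quants q F → (τ : Path d μ d′ ν) →
              View {Ax} {Call} q F (yield τ) (instances τ) (U at ν)
  path-view {F = F} qf μ≡ τ = view F qf (subst (λ A → Trail A _ _ _) μ≡ (trail τ))

  -- The Herbrand system against the evaluated proof.

  module _ (P : SemiProofSchema) where
    open SemiProofSchema P

    private
      toList-apply : ∀ σ {k} (θ : Vec (Term 0) k) {ts} → Vec.toList θ ≡ ts →
                     Vec.toList (Vec.map (applyᵗ σ) θ) ≡ List.map (applyᵗ σ) ts
      toList-apply σ θ refl = Vecₚ.toList-map (applyᵗ σ) θ

    move-toCaller : ∀ σ {T} (c : Schemata.Call L symbols T) (ν : Occ T) →
                    move (toCaller P σ c) ν ≡ Call.calleeOcc c ν
    move-toCaller σ c (inj₁ i) = refl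
    move-toCaller σ c (inj₂ i) = refl

    at-callee : ∀ {T} (c : Schemata.Call L symbols T) (ν : Occ T) →
                T at ν ≡ psub (Call.θ c) (Seq (Call.callee c) at Call.calleeOcc c ν)
    at-callee c ν = trans (at-move (Call.concl c) ν) (at-mapˢ (psub (Call.θ c)) (Seq (Call.callee c)) (Call.calleeOcc c ν))

    caller-PathTo : ∀ σ {T} (c : Schemata.Call L symbols T) {ν : Occ T} {A ts ax}
                    {d : LKProof P (applyˢ (callAssignment P σ c) (Seq (Call.callee c)))} →
                    PathTo d (Call.calleeOcc c ν) A ts → PathTo (convert ax id (toCaller P σ c) d) ν A ts
    caller-PathTo σ c {ν} {d = d} π =
      convert-PathTo (toCaller P σ c) (subst (λ μ → PathTo d μ _ _) (sym (move-toCaller σ c ν)) π)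

    -- Induction on the derivation of membership. Each clause of `Θ*` brings its own prefix and
    -- matrix, so the formula reached is claimed only to be quantifier-free.
    Θ*⇒path : ∀ {ρ σ β μ} {η : Vec (Term 0) β} (a : Acc (_≺_ P) (ρ , σ)) → Θ* P σ ρ μ η →
              ∃[ A ] QF A × PathTo (evaluate′ P ρ σ a) μ A (Vec.toList η)
    Θ*⇒path {ρ} {σ} (acc rs) (done {T = T} {ν = ν} {θ} σ⊨C _ _ _ τ hi qf) with partition ρ σ
    -- By uniqueness in the partition, the case named by the clause is the one that `evaluate′`
    -- selected.
    ... | j , σ⊨Cⱼ , unique with unique σ⊨C
    ... | refl =
      -- If `τ` ends in a call, the path stops at the root of the proof grafted in there.
      apply σ (T at ν) , QF-psub (asParSub σ) (T at ν) qf ,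
      subst (PathTo _ _ _) (sym (toList-apply σ θ (hi-instances hi)))
            (graft-PathTo σ _ τ (_ , _ , ν , stop , at-mapˢ (apply σ) T ν , refl))
    Θ*⇒path {ρ} {σ} (acc rs) (untouched {T = T} {c} {ν} {η} σ⊨C _ _ μ≡ τ ν≡ θ*) with partition ρ σ
    ... | j , σ⊨Cⱼ , unique with unique σ⊨C
    ... | refl with Θ*⇒path (rs (call σ⊨Cⱼ (callsIn τ here))) θ*
    ... | A , qf , π =
      A , qf , subst (PathTo _ _ A) (trans (cong (λ ts → Vec.toList η List.++ List.map (applyᵗ σ) ts) no-instances)
                                           (Listₚ.++-identityʳ _))
                     (graft-PathTo σ _ τ (caller-PathTo σ c π))
      where
      no-instances : instances τ ≡ []
      no-instances = loop-instances (subst (λ B → Trail B (yield τ) (instances τ) (T at ν)) (trans μ≡ (sym ν≡)) (trail τ))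
    Θ*⇒path {ρ} {σ} (acc rs) (partial {c = c} {ν} {θ} {η} σ⊨C _ _ _ _ τ hi _ θ*) with partition ρ σ
    ... | j , σ⊨Cⱼ , unique with unique σ⊨C
    ... | refl with Θ*⇒path (rs (call σ⊨Cⱼ (callsIn τ here))) θ*
    ... | A , qf , π =
      A , qf , subst (PathTo _ _ A) (sym (trans (Vecₚ.toList-++ η _)
                                                (cong (Vec.toList η List.++_) (toList-apply σ θ (hi-instances hi)))))
                     (graft-PathTo σ _ τ (caller-PathTo σ c π))

    -- The caller sees a parameter instance of the callee's formula; prefix length and
    -- quantifier-freeness carry back to the original, as the recursion requires.
    callee-matrix : ∀ {T} (c : Schemata.Call L symbols T) (ν : Occ T) (B : Form β) → T at ν ≡ quants q B → QF B →
                    Σ[ A ∈ Form β ] QF A × Seq (Call.callee c) at Call.calleeOcc c ν ≡ quants q A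
    callee-matrix c ν B ν≡ qf
      with psub-quants⁻¹ (Call.θ c) _ B (trans (sym (at-callee c ν)) ν≡)
    ... | A , callee≡ , refl = A , QF-psub⁻¹ (Call.θ c) A qf , callee≡

    callee-path : ∀ σ {T} (c : Schemata.Call L symbols T) {ν : Occ T} {ax}
                          (d : LKProof P (applyˢ (callAssignment P σ c) (Seq (Call.callee c))))
                          {V} {a : AxiomImage P V} {ν′} (π : Path (convert ax id (toCaller P σ c) d) ν (axiom a) ν′) →
                          ∃[ V′ ] Σ[ a′ ∈ AxiomImage P V′ ] ∃[ ν″ ]
                            Σ[ π′ ∈ Path d (Call.calleeOcc c ν) (axiom a′) ν″ ] instances π′ ≡ instances π
    callee-path σ c {ν} d π with unconvert (toCaller P σ c) d π
    ... | V′ , a′ , ν″ , π′ , π≡ rewrite move-toCaller σ c ν = V′ , a′ , ν″ , π′ , sym π≡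

    -- Indexed by a list, since the instances of composed paths are concatenated; that the list has
    -- length `β` is part of the claim.
    Generated : ∀ σ ρ → Occ (Seq ρ) → ℕ → List (Term 0) → Set₁
    Generated σ ρ μ β ts = Σ[ η ∈ Vec (Term 0) β ] Vec.toList η ≡ ts × Θ* P σ ρ μ η

    module _ {σ : Assignment} {ρ : R} {j : Fin (#cases ρ)} {β : ℕ} {q : Quantifier} {F : Form β} {μ : Occ (Seq ρ)}
             (σ⊨C : σ ⊨ C ρ j) (1≤β : 1 ≤ β) (qf : QF F) (μ≡ : Seq ρ at μ ≡ quants q F) where

      -- Axioms are atomic, so no quantifier is left over there.
      generated-at-axiom : ∀ {U} {a : Axiom (C ρ j) U} {ν} (τ : Path (ξ ρ j) μ (axiom a) ν) →
                           Generated σ ρ μ β (List.map (applyᵗ σ) (instances τ))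
      generated-at-axiom {a = a} {ν} τ with path-view {F = F} qf μ≡ τ
      ... | untouched _ _ ν≡       = contradiction (subst QF ν≡ (axiom-QF a ν)) (¬QF-quants 1≤β F)
      ... | partial 1≤k _ _ _ _ ν≡ = contradiction (subst QF ν≡ (axiom-QF a ν)) (¬QF-quants 1≤k _)
      ... | complete θ θ≡ F∈ _     =
        Vec.map (applyᵗ σ) θ , toList-apply σ θ θ≡ , done σ⊨C 1≤β qf μ≡ τ (atAxiom θ≡ F∈) (axiom-QF a ν)

      -- `ts` stands for the instances of the trace inside the callee. If the formula at the call is
      -- quantifier-free, the system stops with `done`, and the first hypothesis on `ts` ensures
      -- that nothing is lost. The recursive result is assumed for every matrix, since the one in
      -- the callee is known only after the case split.
      generated-at-call : ∀ {T} {c : Schemata.Call L symbols T} {ν ts} (τ : Path (ξ ρ j) μ (call c) ν) →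
        (QF (T at ν) → ts ≡ []) →
        (∀ {k} (A : Form k) → 1 ≤ k → QF A → Seq (Call.callee c) at Call.calleeOcc c ν ≡ quants q A →
         Generated (callAssignment P σ c) (Call.callee c) (Call.calleeOcc c ν) k ts) →
        Generated σ ρ μ β (ts List.++ List.map (applyᵗ σ) (instances τ))
      generated-at-call {c = c} {ν} {ts} τ QF⇒[] generated with path-view {F = F} qf μ≡ τ
      ... | complete θ θ≡ F∈ ν≼ rewrite QF⇒[] (QF-≼ ν≼ (QF-sub _ F qf)) =
        Vec.map (applyᵗ σ) θ , toList-apply σ θ θ≡ ,
        done σ⊨C 1≤β qf μ≡ τ (complete θ≡ F∈ ν≼) (QF-≼ ν≼ (QF-sub _ F qf))
      ... | untouched _ τ≡ ν≡ =
        let A , qfA , callee≡ = callee-matrix c ν F ν≡ qf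
            η , η≡ , η∈       = generated A 1≤β qfA callee≡
        in η ,
           trans η≡ (sym (trans (cong (λ us → ts List.++ List.map (applyᵗ σ) us) τ≡) (Listₚ.++-identityʳ ts))) ,
           untouched σ⊨C 1≤β qf μ≡ τ ν≡ η∈
      ... | partial {k} 1≤k 1≤i refl θ θ≡ ν≡ =
        let A , qfA , callee≡ = callee-matrix c ν (partially k F θ) ν≡ (QF-sub _ F qf)
            η , η≡ , η∈       = generated A 1≤k qfA callee≡
        in η Vec.++ Vec.map (applyᵗ σ) θ ,
           trans (Vecₚ.toList-++ η _) (cong₂ List._++_ η≡ (toList-apply σ θ θ≡)) ,
           partial σ⊨C 1≤k 1≤i qf μ≡ τ (partial 1≤k 1≤i θ≡ ν≡) ν≡ η∈

    -- Recursion on accessibility, in step with `evaluate′`: a trace that passes a call continues as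
    -- a trace in the proof of a smaller configuration.
    path⇒Θ* : ∀ {ρ σ q β μ} (acc≺ : Acc (_≺_ P) (ρ , σ)) (F : Form β) → 1 ≤ β → QF F → Seq ρ at μ ≡ quants q F →
              ∀ {U} {a : AxiomImage P U} {ν} (π : Path (evaluate′ P ρ σ acc≺) μ (axiom a) ν) →
              Generated σ ρ μ β (instances π)
    path⇒Θ* {ρ} {σ} {μ = μ} (acc rs) F 1≤β qf μ≡ π with partition ρ σ
    ... | j , σ⊨C , _ with factor σ _ (ξ ρ j) _ π
    ... | toAxiom τ π≡ = subst (Generated σ ρ μ _) (sym π≡) (generated-at-axiom σ⊨C 1≤β qf μ≡ τ)
    ... | toCall {U} {c = c} {ν} τ π′ π≡ =
      subst (Generated σ ρ μ _) (sym π≡) (generated-at-call σ⊨C 1≤β qf μ≡ τ QF⇒[] λ A 1≤k qfA callee≡ →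
        let acc′              = rs (call σ⊨C (callsIn τ here))
            _ , _ , _ , π″ , π″≡ = callee-path σ c (evaluate′ P _ _ acc′) π′
        in subst (Generated _ _ _ _) π″≡ (path⇒Θ* acc′ A 1≤k qfA callee≡ π″))
      where
      QF⇒[] : QF (U at ν) → instances π′ ≡ []
      QF⇒[] qfν with QF-trail (subst QF (sym (at-mapˢ (apply σ) U ν)) (QF-psub (asParSub σ) (U at ν) qfν)) (trail π′)
      ... | _ , _ , π′≡ = π′≡

-- Soundness and completeness for the main symbol.

toList-injective : {A : Set} {n : ℕ} {xs ys : Vec A n} → Vec.toList xs ≡ Vec.toList ys → xs ≡ ys
toList-injective {xs = xs} {ys} xs≡ys =
  trans (sym (Vecₚ.cast-is-id refl xs)) (Vecₚ.toList-injective refl xs ys xs≡ys)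

theorem3p1 : (L : Language) → let open Schemata L in
    (P : ProofSchema) → let open ProofSchema P in
    (∀ ρ j → QFCuts (ξ ρ j)) →
    (∀ ρ → Skolemized (Seq ρ) × PrenexSequent (Seq ρ)) →
    (μ₀ : Occ (Seq ρ₀)) (q : Quantifier) (β : ℕ) (F′ : Form β) →
    1 ≤ β → QF F′ → Seq ρ₀ at μ₀ ≡ quants q F′ →
    (σ : Assignment) →
    let φσ = evaluate ρ₀ σ in
    (∀ (θ : Vec (Term 0) β) → Θ* semi σ ρ₀ μ₀ θ →
    ∃[ T ] Σ[ d ∈ LKProof semi T ] ∃[ ν ] Σ[ π ∈ Path φσ μ₀ d ν ]
    T at ν ≡ apply σ F′ ⟦ θ ⟧ × Vec.toList θ ≡ instances π)
    ×
    (∀ {T a ν} (τ : Path φσ μ₀ (axiom {S = T} a) ν) →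
    ∃[ θ ] Hi q (apply σ F′) τ {β} θ × Θ* semi σ ρ₀ μ₀ θ)
theorem3p1 L P _ _ μ₀ q β F′ 1≤β qf μ₀≡ σ = sound , all-generated
  where
  open Schemata L
  open ProofSchema P

  φσ : LKProof semi (applyˢ σ (Seq ρ₀))
  φσ = evaluate ρ₀ σ

  σF′-QF : QF (apply σ F′)
  σF′-QF = QF-psub L (asParSub σ) F′ qf

  σμ₀≡ : applyˢ σ (Seq ρ₀) at μ₀ ≡ quants q (apply σ F′)
  σμ₀≡ = trans (at-mapˢ L (apply σ) (Seq ρ₀) μ₀)
               (trans (cong (apply σ) μ₀≡) (psub-quants L (asParSub σ) F′))

  -- A prefix that is not exhausted would leave a quantifier in the final formula.
  view-at-QF : ∀ {T} {d : LKProof semi T} {ν} (π : Path φσ μ₀ d ν) → QF (T at ν) →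
               Σ[ θ ∈ Vec (Term 0) β ] Vec.toList θ ≡ instances π × apply σ F′ ⟦ θ ⟧ ∈ yield π
  view-at-QF π qfν with path-view L {F = apply σ F′} σF′-QF σμ₀≡ π
  ... | untouched _ _ ν≡       = contradiction (subst QF ν≡ qfν) (¬QF-quants L 1≤β _)
  ... | partial 1≤k _ _ _ _ ν≡ = contradiction (subst QF ν≡ qfν) (¬QF-quants L 1≤k _)
  ... | complete θ θ≡ F∈ _     = θ , θ≡ , F∈

  sound : ∀ (θ : Vec (Term 0) β) → Θ* semi σ ρ₀ μ₀ θ →
          ∃[ T ] Σ[ d ∈ LKProof semi T ] ∃[ ν ] Σ[ π ∈ Path φσ μ₀ d ν ]
            T at ν ≡ apply σ F′ ⟦ θ ⟧ × Vec.toList θ ≡ instances π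
  sound θ θ∈ with Θ*⇒path L semi (≺-wf semi canonic (ρ₀ , σ)) θ∈
  -- The path may run on into a proper subformula of the instance.
  ... | A , qfA , T , d , ν , π , ν≡ , θ≡ with view-at-QF π (subst QF (sym ν≡) qfA)
  -- Equal lists of instances identify `θ′` with `θ`, so the required instance occurs on `π`; the
  -- path is cut off there without losing instances.
  ... | θ′ , θ′≡ , F∈ =
    subst (PathTo L φσ μ₀ (apply σ F′ ⟦ θ ⟧)) (sym θ≡)
      (path-to-QF L π (subst (λ θ → apply σ F′ ⟦ θ ⟧ ∈ yield π) (toList-injective (trans θ′≡ (sym θ≡))) F∈)
                  (QF-sub L (lookup θ) (apply σ F′) σF′-QF))

  image-QF : ∀ {T} → AxiomImage semi T → ∀ ν → QF (T at ν)
  image-QF (image σ′ _ _ {S₀} _ a e) ν =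
    subst QF (sym (trans (at-move L e ν) (at-mapˢ L (apply σ′) S₀ (move e ν))))
          (QF-psub L (asParSub σ′) (S₀ at move e ν) (axiom-QF L a (move e ν)))

  all-generated : ∀ {T a ν} (τ : Path φσ μ₀ (axiom {S = T} a) ν) →
                  ∃[ θ ] Hi q (apply σ F′) τ {β} θ × Θ* semi σ ρ₀ μ₀ θ
  -- The first result gives hi in the evaluated proof, the second membership; both vectors list
  -- `instances τ` and therefore coincide.
  all-generated {T} {a} {ν} τ with view-at-QF τ (image-QF a ν)
                            | path⇒Θ* L semi (≺-wf semi canonic (ρ₀ , σ)) F′ 1≤β qf μ₀≡ τ
  ... | θ , θ≡ , F∈ | η , η≡ , η∈ =
    θ , atAxiom θ≡ F∈ , subst (Θ* semi σ ρ₀ μ₀) (toList-injective (trans η≡ (sym θ≡))) η∈
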